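{- Let $T$ be a tree on $n\ge 3$ vertices. Then $$\frac{2}{n-1}\le \gamma(T)\le \frac{n}{2n-3}.$$ Equality holds in the lower bound if and only if $T$ is isomorphic to the path $P_n$, and equality holds in the upper bound if and only if $T$ is isomorphic to the star $S_n$.
   Context: For a finite simple undirected graph $G$ with $n$ vertices, let $\mathcal{F}=\{x\in\mathbb{R}^{V(G)} : \sum_{v} x_v = 0,\ \|x\|_\infty = 1\}$, for $x\in\mathcal{F}$ let $\gamma_x(G)=\max_{uv\in E(G)}|x_u-x_v|$, and $\gamma(G)=\min_{x\in\mathcal{F}}\gamma_x(G)$. The star $S_n$ is the tree on $n$ vertices with one vertex adjacent to all other $n-1$ vertices. -}

module Defs where

open import Algebra.Bundles using (module CommutativeMonoid)
import Algebra.Properties.AbelianGroup as AbelianGroupProperties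
import Algebra.Properties.CommutativeSemigroup as CommutativeSemigroupProperties
open import Data.Fin.Base using (Fin; toℕ)
open import Data.Integer.Base using (+_)
open import Data.List.Base using (List; []; _∷_; _∷ʳ_; length; map; foldr; filter; allFin; cartesianProduct)
open import Data.List.Relation.Unary.Linked using (Linked)
open import Data.List.Relation.Unary.Unique.Propositional using (Unique)
open import Data.Nat.Base as ℕ using (ℕ; suc; s≤s; z≤n; >-nonZero)
import Data.Nat.Properties as ℕ
open import Data.Product.Base using (Σ; ∃; _×_; _,_; proj₁; proj₂; uncurry)
open import Data.Rational.Base as ℚ using (ℚ; 0ℚ; 1ℚ; ½)
import Data.Rational.Properties as ℚ
open import Data.Sum.Base using (_⊎_; inj₁; inj₂)
import Data.Sum.Base as Sum
import Data.Vec.Functional as Vector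
open import Data.Vec.Functional using (Vector)
open import Function.Bundles using (_↔_; _⇔_; Inverse)
open import Level using (0ℓ)
open import Relation.Binary.Core using (Rel)
open import Relation.Binary.Construct.Closure.ReflexiveTransitive using (Star)
open import Relation.Binary.Definitions using (Symmetric; Irreflexive; Decidable)
open import Relation.Binary.PropositionalEquality.Core using (_≡_; _≢_; refl; sym; trans; cong; subst)
open import Relation.Nullary.Decidable using (_×-dec_; _⊎-dec_; ¬?)
open import Relation.Nullary.Negation.Core using (¬_)

-- Reals are Cauchy sequences of rationals; equality of reals is _≃_, not _≡_.
record ℝ : Set where
  constructor mkℝ
  field
    seq    : ℕ → ℚ
    cauchy : ∀ ε → 0ℚ ℚ.< ε → ∃ λ N → ∀ i j → N ℕ.≤ i → N ℕ.≤ j →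
             ℚ.∣ seq i ℚ.- seq j ∣ ℚ.≤ ε

open ℝ public

infix 4 _≃_ _≤_

_≃_ : Rel ℝ 0ℓ
x ≃ y = ∀ ε → 0ℚ ℚ.< ε → ∃ λ N → ∀ k → N ℕ.≤ k → ℚ.∣ seq x k ℚ.- seq y k ∣ ℚ.≤ ε

_≤_ : Rel ℝ 0ℓ
x ≤ y = ∀ ε → 0ℚ ℚ.< ε → ∃ λ N → ∀ k → N ℕ.≤ k → seq x k ℚ.≤ seq y k ℚ.+ ε

private
  0<½* : ∀ {ε} → 0ℚ ℚ.< ε → 0ℚ ℚ.< ½ ℚ.* ε
  0<½* {ε} 0<ε = subst (ℚ._< ½ ℚ.* ε) (ℚ.*-zeroʳ ½) (ℚ.*-monoʳ-<-pos ½ 0<ε)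

  ½+½ : ∀ ε → ½ ℚ.* ε ℚ.+ ½ ℚ.* ε ≡ ε
  ½+½ ε = trans (sym (ℚ.*-distribʳ-+ ε ½ ½)) (ℚ.*-identityˡ ε)

  +-diff : ∀ a b c d → (a ℚ.+ b) ℚ.- (c ℚ.+ d) ≡ (a ℚ.- c) ℚ.+ (b ℚ.- d)
  +-diff a b c d = trans
    (cong ((a ℚ.+ b) ℚ.+_) (ℚ.neg-distrib-+ c d))
    (CommutativeSemigroupProperties.interchange
      (CommutativeMonoid.commutativeSemigroup ℚ.+-0-commutativeMonoid)
      a b (ℚ.- c) (ℚ.- d))

  neg-diff : ∀ a c → (ℚ.- a) ℚ.- (ℚ.- c) ≡ ℚ.- (a ℚ.- c)
  neg-diff a c = sym (ℚ.neg-distrib-+ a (ℚ.- c))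

  a-c+c : ∀ a c → (a ℚ.- c) ℚ.+ c ≡ a
  a-c+c a c = AbelianGroupProperties.//-rightDividesˡ ℚ.+-0-abelianGroup c a

  ε+c-c : ∀ ε c → (ε ℚ.+ c) ℚ.- c ≡ ε
  ε+c-c ε c = AbelianGroupProperties.//-rightDividesʳ ℚ.+-0-abelianGroup c ε

  c-a : ∀ a c → ℚ.- (a ℚ.- c) ≡ c ℚ.- a
  c-a a c = AbelianGroupProperties.⁻¹-anti-homo-// ℚ.+-0-abelianGroup a c

  p≤∣p∣ : ∀ p → p ℚ.≤ ℚ.∣ p ∣
  p≤∣p∣ p with ℚ.≤-total 0ℚ p
  ... | inj₁ 0≤p = ℚ.≤-reflexive (sym (ℚ.0≤p⇒∣p∣≡p 0≤p))
  ... | inj₂ p≤0 = ℚ.≤-trans p≤0 (ℚ.0≤∣p∣ p)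

  ∣-∣≤⇒≤+ : ∀ a c {ε} → ℚ.∣ a ℚ.- c ∣ ℚ.≤ ε → a ℚ.≤ ε ℚ.+ c
  ∣-∣≤⇒≤+ a c h =
    subst (ℚ._≤ _) (a-c+c a c) (ℚ.+-monoˡ-≤ c (ℚ.≤-trans (p≤∣p∣ _) h))

  ∣-∣-sym : ∀ a c {ε} → ℚ.∣ a ℚ.- c ∣ ℚ.≤ ε → ℚ.∣ c ℚ.- a ∣ ℚ.≤ ε
  ∣-∣-sym a c = subst (ℚ._≤ _)
    (trans (sym (ℚ.∣-p∣≡∣p∣ (a ℚ.- c))) (cong ℚ.∣_∣ (c-a a c)))

  ≤+⇒∣-∣≤ : ∀ a c {ε} → a ℚ.≤ ε ℚ.+ c → c ℚ.≤ ε ℚ.+ a → ℚ.∣ a ℚ.- c ∣ ℚ.≤ ε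
  ≤+⇒∣-∣≤ a c {ε} h k with ℚ.∣p∣≡p∨∣p∣≡-p (a ℚ.- c)
  ... | inj₁ e = subst (ℚ._≤ ε) (sym e)
          (subst (_ ℚ.≤_) (ε+c-c ε c) (ℚ.+-monoˡ-≤ (ℚ.- c) h))
  ... | inj₂ e = subst (ℚ._≤ ε) (sym (trans e (c-a a c)))
          (subst (_ ℚ.≤_) (ε+c-c ε a) (ℚ.+-monoˡ-≤ (ℚ.- a) k))

  ⊔-≤+ : ∀ a b c d ε → a ℚ.≤ ε ℚ.+ c → b ℚ.≤ ε ℚ.+ d → a ℚ.⊔ b ℚ.≤ ε ℚ.+ (c ℚ.⊔ d)
  ⊔-≤+ a b c d ε h k = ℚ.⊔-lub
    (ℚ.≤-trans h (ℚ.+-monoʳ-≤ ε (ℚ.p≤p⊔q c d)))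
    (ℚ.≤-trans k (ℚ.+-monoʳ-≤ ε (ℚ.p≤q⊔p c d)))

  ⊔-diff : ∀ a b c d {ε} → ℚ.∣ a ℚ.- c ∣ ℚ.≤ ε → ℚ.∣ b ℚ.- d ∣ ℚ.≤ ε →
           ℚ.∣ (a ℚ.⊔ b) ℚ.- (c ℚ.⊔ d) ∣ ℚ.≤ ε
  ⊔-diff a b c d {ε} p q = ≤+⇒∣-∣≤ (a ℚ.⊔ b) (c ℚ.⊔ d)
    (⊔-≤+ a b c d ε (∣-∣≤⇒≤+ a c p) (∣-∣≤⇒≤+ b d q))
    (⊔-≤+ c d a b ε (∣-∣≤⇒≤+ c a (∣-∣-sym a c p)) (∣-∣≤⇒≤+ d b (∣-∣-sym b d q)))

fromℚ : ℚ → ℝ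
fromℚ q = mkℝ (λ _ → q) λ ε 0<ε → 0 , λ _ _ _ _ →
  subst (ℚ._≤ ε) (cong ℚ.∣_∣ (sym (ℚ.+-inverseʳ q))) (ℚ.<⇒≤ 0<ε)

0ℝ 1ℝ : ℝ
0ℝ = fromℚ 0ℚ
1ℝ = fromℚ 1ℚ

infixl 6 _+_ _-_ _⊔_
infix  8 -_

_+_ : ℝ → ℝ → ℝ
x + y = mkℝ (λ k → seq x k ℚ.+ seq y k) λ ε 0<ε →
  let (M , p) = cauchy x (½ ℚ.* ε) (0<½* 0<ε)
      (N , q) = cauchy y (½ ℚ.* ε) (0<½* 0<ε)
  in M ℕ.⊔ N , λ i j m n → begin
    ℚ.∣ (seq x i ℚ.+ seq y i) ℚ.- (seq x j ℚ.+ seq y j) ∣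
      ≡⟨ cong ℚ.∣_∣ (+-diff (seq x i) (seq y i) (seq x j) (seq y j)) ⟩
    ℚ.∣ (seq x i ℚ.- seq x j) ℚ.+ (seq y i ℚ.- seq y j) ∣
      ≤⟨ ℚ.∣p+q∣≤∣p∣+∣q∣ (seq x i ℚ.- seq x j) (seq y i ℚ.- seq y j) ⟩
    ℚ.∣ seq x i ℚ.- seq x j ∣ ℚ.+ ℚ.∣ seq y i ℚ.- seq y j ∣
      ≤⟨ ℚ.+-mono-≤ (p i j (ℕ.m⊔n≤o⇒m≤o M N m) (ℕ.m⊔n≤o⇒m≤o M N n))
                    (q i j (ℕ.m⊔n≤o⇒n≤o M N m) (ℕ.m⊔n≤o⇒n≤o M N n)) ⟩
    ½ ℚ.* ε ℚ.+ ½ ℚ.* ε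
      ≡⟨ ½+½ ε ⟩
    ε ∎
  where open ℚ.≤-Reasoning

-_ : ℝ → ℝ
- x = mkℝ (λ k → ℚ.- seq x k) λ ε 0<ε →
  let (N , p) = cauchy x ε 0<ε
  in N , λ i j m n → subst (ℚ._≤ ε)
    (sym (trans (cong ℚ.∣_∣ (neg-diff (seq x i) (seq x j))) (ℚ.∣-p∣≡∣p∣ _)))
    (p i j m n)

_-_ : ℝ → ℝ → ℝ
x - y = x + (- y)

_⊔_ : ℝ → ℝ → ℝ
x ⊔ y = mkℝ (λ k → seq x k ℚ.⊔ seq y k) λ ε 0<ε →
  let (M , p) = cauchy x ε 0<ε
      (N , q) = cauchy y ε 0<ε
  in M ℕ.⊔ N , λ i j m n →
    ⊔-diff (seq x i) (seq y i) (seq x j) (seq y j)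
      (p i j (ℕ.m⊔n≤o⇒m≤o M N m) (ℕ.m⊔n≤o⇒m≤o M N n))
      (q i j (ℕ.m⊔n≤o⇒n≤o M N m) (ℕ.m⊔n≤o⇒n≤o M N n))

∣_∣ : ℝ → ℝ
∣ x ∣ = x ⊔ - x

-- Maximum of a finite family of non-negative reals; starting the fold at 0
-- changes nothing except that the empty family gets the value 0.
max₀ : List ℝ → ℝ
max₀ = foldr _⊔_ 0ℝ

∑ : ∀ {n} → Vector ℝ n → ℝ
∑ = Vector.foldr _+_ 0ℝ

∥_∥∞ : ∀ {n} → Vector ℝ n → ℝ
∥_∥∞ {n} x = max₀ (map (λ v → ∣ x v ∣) (allFin n))

record Graph (n : ℕ) : Set₁ where
  field
    Adj     : Rel (Fin n) 0ℓ
    adj?    : Decidable Adj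
    symm    : Symmetric Adj
    irrefl  : Irreflexive _≡_ Adj

open Graph public

-- Every edge occurs twice, once in each orientation.
edges : ∀ {n} → Graph n → List (Fin n × Fin n)
edges {n} G = filter (uncurry (adj? G)) (cartesianProduct (allFin n) (allFin n))

Connected : ∀ {n} → Graph n → Set
Connected G = ∀ u v → Star (Adj G) u v

-- A cycle is a closed walk v, vs, v whose vertices v, vs are pairwise
-- distinct and at least three in number.
Cycle : ∀ {n} → Graph n → Set
Cycle {n} G = Σ (Fin n) λ v → Σ (List (Fin n)) λ vs →
  2 ℕ.≤ length vs × Unique (v ∷ vs) × Linked (Adj G) (v ∷ (vs ∷ʳ v))

IsTree : ∀ {n} → Graph n → Set
IsTree G = Connected G × ¬ Cycle G

infix 4 _≅_

_≅_ : ∀ {m n} → Graph m → Graph n → Set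
_≅_ {m} {n} G H = Σ (Fin m ↔ Fin n) λ f →
  ∀ u v → Adj G u v ⇔ Adj H (Inverse.to f u) (Inverse.to f v)

path : ∀ n → Graph n
path n = record
  { Adj    = λ u v → (toℕ v ≡ suc (toℕ u)) ⊎ (toℕ u ≡ suc (toℕ v))
  ; adj?   = λ u v → (toℕ v ℕ.≟ suc (toℕ u)) ⊎-dec (toℕ u ℕ.≟ suc (toℕ v))
  ; symm   = Sum.swap
  ; irrefl = λ { refl (inj₁ e) → ℕ.1+n≢n (sym e) ; refl (inj₂ e) → ℕ.1+n≢n (sym e) }
  }

star : ∀ n → Graph n
star n = record
  { Adj    = λ u v → (toℕ u ≡ 0 × toℕ v ≢ 0) ⊎ (toℕ v ≡ 0 × toℕ u ≢ 0)
  ; adj?   = λ u v → ((toℕ u ℕ.≟ 0) ×-dec ¬? (toℕ v ℕ.≟ 0))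
               ⊎-dec ((toℕ v ℕ.≟ 0) ×-dec ¬? (toℕ u ℕ.≟ 0))
  ; symm   = Sum.swap
  ; irrefl = λ { refl (inj₁ (z , nz)) → nz z ; refl (inj₂ (z , nz)) → nz z }
  }

𝓕 : ∀ {n} → Vector ℝ n → Set
𝓕 x = ∑ x ≃ 0ℝ × ∥ x ∥∞ ≃ 1ℝ

γ[_] : ∀ {n} → Vector ℝ n → Graph n → ℝ
γ[ x ] G = max₀ (map (λ (u , v) → ∣ x u - x v ∣) (edges G))

infix 4 _IsGammaOf_

-- g is the minimum of γ[ x ] G over x in 𝓕; such a g is unique up to _≃_.
_IsGammaOf_ : ∀ {n} → ℝ → Graph n → Set
_IsGammaOf_ {n} g G = (Σ (Vector ℝ n) λ x → 𝓕 x × γ[ x ] G ≃ g)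
                    × (∀ x → 𝓕 x → g ≤ γ[ x ] G)

lowerBound upperBound : ∀ n → 3 ℕ.≤ n → ℚ
lowerBound n n≥3 = (+ 2 ℚ./ (n ℕ.∸ 1))
  {{ >-nonZero (ℕ.m<n⇒0<n∸m (ℕ.≤-trans (s≤s (s≤s z≤n)) n≥3)) }}
upperBound n n≥3 = (+ n ℚ./ (2 ℕ.* n ℕ.∸ 3))
  {{ >-nonZero (ℕ.m<n⇒0<n∸m (ℕ.≤-trans (s≤s n≥3) n<2n)) }}
  where
  n<2n : n ℕ.< 2 ℕ.* n
  n<2n = subst (n ℕ.<_) (ℕ.*-comm n 2)
    (ℕ.m<m*n n 2 {{ >-nonZero (ℕ.≤-trans (s≤s z≤n) n≥3) }} (s≤s (s≤s z≤n)))

{-# OPTIONS --safe #-}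

-- For a connected graph, γ(G) = n / max_v D(v), where D(v) = ∑_u d(v,u) is
-- the transmission of v. If x_v = 1 and all edge gaps are at most γ, then
-- x_u ≥ 1 − γ d(v,u), and summing over u gives 0 ≥ n − γ D(v). Conversely,
-- for v of maximal transmission, x_u = 1 − (n / D(v)) d(v,u) has sum 0, and
-- n d(v,u) ≤ D(v) + D(u) ≤ 2 D(v) shows x_u ≥ −1.
--
-- Every u has at least d(v,u) vertices strictly closer to v, and counting
-- such pairs gives 2 D(v) ≤ n (n − 1), with equality only if all distances
-- from v differ, i.e. only for a path. A leaf has one vertex at distance 1
-- and all others at distance at least 2, so its transmission is at least
-- 2n − 3, with equality only if all other vertices are adjacent to its
-- neighbour, i.e. (trees having no triangles) only for a star.
module Submission where

import Algebra.Properties.Semiring.Sum as Sum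
open import Data.Bool.Base using (if_then_else_)
open import Data.Fin.Base using (Fin; zero; suc; toℕ; fromℕ<; punchOut)
import Data.Fin.Permutation as Perm
import Data.Fin.Properties as Fin
open import Data.Integer.Base as ℤ using (+_)
import Data.Integer.Properties as ℤ
open import Data.List.Base using (List; []; _∷_; _∷ʳ_; length; lookup; map; allFin; cartesianProduct)
open import Data.List.Extrema.Nat using (argmax; f[xs]≤f[argmax])
import Data.List.Membership.DecPropositional as DecMembership
open import Data.List.Membership.Propositional using (_∈_)
open import Data.List.Membership.Propositional.Properties
  using (∈-allFin; ∈-lookup; ∈-filter⁺; ∈-filter⁻; ∈-cartesianProduct⁺)
open import Data.List.Relation.Unary.All as All using (All; []; _∷_)
open import Data.List.Relation.Unary.All.Properties using (¬Any⇒All¬)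
open import Data.List.Relation.Unary.AllPairs using ([]; _∷_)
open import Data.List.Relation.Unary.Any using (here; there)
open import Data.List.Relation.Unary.Linked using (Linked; [-]; _∷_)
open import Data.List.Relation.Unary.Unique.Propositional using (Unique)
open import Data.Nat.Base as ℕ using (ℕ; zero; suc; s≤s; z≤n)
import Data.Nat.Properties as ℕ
open import Data.Nat.Tactic.RingSolver using (solve-∀)
open import Data.Product.Base using (Σ; ∃; _×_; _,_; proj₁; proj₂; uncurry)
open import Data.Rational.Base as ℚ using (ℚ; 0ℚ; 1ℚ)
import Data.Rational.Properties as ℚ
open import Data.Rational.Solver using (module +-*-Solver)
import Data.Rational.Unnormalised.Base as ℚᵘ
import Data.Rational.Unnormalised.Properties as ℚᵘ
open import Data.Sum.Base using (inj₁; inj₂)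
open import Data.Unit.Base using (tt)
open import Data.Vec.Functional using (Vector)
open import Function.Base using (_∘_)
open import Function.Bundles using (_↔_; _⇔_; Inverse; Equivalence; Injection; mk⇔)
open import Function.Properties.Inverse using (Inverse⇒Injection)
open import Relation.Binary.Construct.Closure.ReflexiveTransitive using (Star; _◅_) renaming (ε to nil)
open import Relation.Binary.PropositionalEquality
open import Relation.Nullary.Decidable
  using (Dec; yes; no; does; _×-dec_; _⊎-dec_; ¬?; dec-true; dec-false; decidable-stable)
open import Relation.Nullary.Negation using (¬_; contradiction)
open import Defs

open +-*-Solver using (solve; con; _:+_; _:*_; :-_; _:-_; _:=_)
open module FinMembership {n} = DecMembership (Fin._≟_ {n}) using (_∈?_)
module ∑ℕ = Sum ℕ.+-*-semiring

-- Finite sums of natural numbers and indicators.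

sum : ∀ {n} → Vector ℕ n → ℕ
sum = ∑ℕ.sum

sum-const : ∀ n c → sum {n} (λ _ → c) ≡ n ℕ.* c
sum-const zero    c = refl
sum-const (suc n) c = cong (c ℕ.+_) (sum-const n c)

sum-mono-≤ : ∀ {n} {f g : Vector ℕ n} → (∀ i → f i ℕ.≤ g i) → sum f ℕ.≤ sum g
sum-mono-≤ {zero}  f≤g = z≤n
sum-mono-≤ {suc n} f≤g = ℕ.+-mono-≤ (f≤g zero) (sum-mono-≤ (f≤g ∘ suc))

-- Slack in one term cannot be recovered in the others. Both equality cases, of the level count and
-- of the leaf bound, are read off through this.
sum-mono-≤-tight : ∀ {n} {f g : Vector ℕ n} → (∀ i → f i ℕ.≤ g i) →
                   sum g ℕ.≤ sum f → ∀ i → f i ≡ g i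
sum-mono-≤-tight {suc n} {f} {g} f≤g ∑g≤∑f zero = ℕ.≤-antisym (f≤g zero)
  (ℕ.+-cancelʳ-≤ (sum (f ∘ suc)) (g zero) (f zero)
    (ℕ.≤-trans (ℕ.+-monoʳ-≤ (g zero) (sum-mono-≤ (f≤g ∘ suc))) ∑g≤∑f))
sum-mono-≤-tight {suc n} {f} {g} f≤g ∑g≤∑f (suc i) = sum-mono-≤-tight (f≤g ∘ suc)
  (ℕ.+-cancelˡ-≤ (f zero) _ _
    (ℕ.≤-trans (ℕ.+-monoˡ-≤ (sum (g ∘ suc)) (f≤g zero)) ∑g≤∑f)) i

-- Gauss's 2 (0 + ... + (n - 1)) = n (n - 1), with `n` added on both sides to avoid truncated
-- subtraction.
sum-toℕ : ∀ n → sum {n} toℕ ℕ.+ sum {n} toℕ ℕ.+ n ≡ n ℕ.* n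
sum-toℕ zero    = refl
sum-toℕ (suc n) = begin
  sum {n} (suc ∘ toℕ) ℕ.+ sum {n} (suc ∘ toℕ) ℕ.+ suc n
    ≡⟨ cong (λ s → s ℕ.+ s ℕ.+ suc n) (trans (∑ℕ.∑-distrib-+ {n} (λ _ → 1) toℕ)
         (cong (ℕ._+ t) (trans (sum-const n 1) (ℕ.*-identityʳ n)))) ⟩
  (n ℕ.+ t) ℕ.+ (n ℕ.+ t) ℕ.+ suc n
    ≡⟨ rearr n t ⟩
  (t ℕ.+ t ℕ.+ n) ℕ.+ suc (n ℕ.+ n)
    ≡⟨ cong (ℕ._+ suc (n ℕ.+ n)) (sum-toℕ n) ⟩
  n ℕ.* n ℕ.+ suc (n ℕ.+ n)
    ≡⟨ square n ⟩
  suc n ℕ.* suc n ∎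
  where
  open ≡-Reasoning
  t = sum {n} toℕ
  rearr : ∀ n t → (n ℕ.+ t) ℕ.+ (n ℕ.+ t) ℕ.+ suc n ≡ (t ℕ.+ t ℕ.+ n) ℕ.+ suc (n ℕ.+ n)
  rearr = solve-∀
  square : ∀ n → n ℕ.* n ℕ.+ suc (n ℕ.+ n) ≡ suc n ℕ.* suc n
  square = solve-∀

𝟙 : ∀ {P : Set} → Dec P → ℕ
𝟙 P? = if does P? then 1 else 0

𝟙-yes : ∀ {P : Set} (P? : Dec P) → P → 𝟙 P? ≡ 1
𝟙-yes P? p = cong (if_then 1 else 0) (dec-true P? p)

𝟙-no : ∀ {P : Set} (P? : Dec P) → ¬ P → 𝟙 P? ≡ 0
𝟙-no P? ¬p = cong (if_then 1 else 0) (dec-false P? ¬p)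

𝟙-+-≤ : ∀ {P Q R : Set} (P? : Dec P) (Q? : Dec Q) (R? : Dec R) →
        (P → R) → (Q → R) → (P → ¬ Q) → 𝟙 P? ℕ.+ 𝟙 Q? ℕ.≤ 𝟙 R?
𝟙-+-≤ (yes p) (yes q) R? f g disjoint = contradiction q (disjoint p)
𝟙-+-≤ (yes p) (no _)  R? f g disjoint = ℕ.≤-reflexive (sym (𝟙-yes R? (f p)))
𝟙-+-≤ (no _)  (yes q) R? f g disjoint = ℕ.≤-reflexive (sym (𝟙-yes R? (g q)))
𝟙-+-≤ (no _)  (no _)  R? f g disjoint = z≤n

sum-𝟙≟ : ∀ {n} (i : Fin n) → sum (λ j → 𝟙 (i Fin.≟ j)) ≡ 1
sum-𝟙≟ {suc n} zero    = cong suc (trans (sum-const n 0) (ℕ.*-zeroʳ n))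
sum-𝟙≟ {suc n} (suc i) = sum-𝟙≟ i

-- Counting the levels of a height function without gaps.

module Gapless {n} (h : Fin n → ℕ) (pred-level : ∀ u k → h u ≡ suc k → ∃ λ w → h w ≡ k) where

  level : ∀ m k u → h u ≡ m → k ℕ.≤ m → ∃ λ w → h w ≡ k
  level m k u hu≡m k≤m with k ℕ.≟ m
  ... | yes refl = u , hu≡m
  level zero    k u hu≡m k≤m | no k≢m = contradiction (ℕ.n≤0⇒n≡0 k≤m) k≢m
  level (suc m) k u hu≡m k≤m | no k≢m with pred-level u m hu≡m
  ... | w , hw≡m = level m k w hw≡m (ℕ.≤-pred (ℕ.≤∧≢⇒< k≤m k≢m))

  below : ℕ → ℕ
  below k = sum (λ w → 𝟙 (h w ℕ.<? k))

  -- Each of the levels 0, ..., k - 1 is occupied. In the induction, an element `w₀` on level `k` is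
  -- counted by `below (suc k)` but not by `below k`.
  ≤below : ∀ k u → k ℕ.≤ h u → k ℕ.≤ below k
  ≤below zero    u k≤hu = z≤n
  ≤below (suc k) u k<hu with level (h u) k u refl (ℕ.<⇒≤ k<hu)
  ... | w₀ , hw₀≡k = begin
    suc k
      ≡⟨ ℕ.+-comm 1 k ⟩
    k ℕ.+ 1
      ≤⟨ ℕ.+-mono-≤ (≤below k u (ℕ.<⇒≤ k<hu)) (ℕ.≤-reflexive (sym (sum-𝟙≟ w₀))) ⟩
    below k ℕ.+ sum (λ w → 𝟙 (w₀ Fin.≟ w))
      ≡⟨ ∑ℕ.∑-distrib-+ (λ w → 𝟙 (h w ℕ.<? k)) (λ w → 𝟙 (w₀ Fin.≟ w)) ⟨
    sum (λ w → 𝟙 (h w ℕ.<? k) ℕ.+ 𝟙 (w₀ Fin.≟ w))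
      ≤⟨ sum-mono-≤ pointwise ⟩
    below (suc k) ∎
    where
    open ℕ.≤-Reasoning
    pointwise : ∀ w → 𝟙 (h w ℕ.<? k) ℕ.+ 𝟙 (w₀ Fin.≟ w) ℕ.≤ 𝟙 (h w ℕ.<? suc k)
    pointwise w = 𝟙-+-≤ (h w ℕ.<? k) (w₀ Fin.≟ w) (h w ℕ.<? suc k) ℕ.m<n⇒m<1+n
      (λ { refl → ℕ.≤-reflexive (cong suc hw₀≡k) })
      (λ { hw<k refl → ℕ.<-irrefl hw₀≡k hw<k })

  -- `u` is one more element besides the at least `h u` lying below it. The bound lets distances
  -- serve as indices in `Fin n`.
  height< : ∀ u → h u ℕ.< n
  height< u = begin
    suc (h u)
      ≡⟨ ℕ.+-comm 1 (h u) ⟩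
    h u ℕ.+ 1
      ≤⟨ ℕ.+-mono-≤ (≤below (h u) u ℕ.≤-refl) (ℕ.≤-reflexive (sym (sum-𝟙≟ u))) ⟩
    below (h u) ℕ.+ sum (λ w → 𝟙 (u Fin.≟ w))
      ≡⟨ ∑ℕ.∑-distrib-+ (λ w → 𝟙 (h w ℕ.<? h u)) (λ w → 𝟙 (u Fin.≟ w)) ⟨
    sum (λ w → 𝟙 (h w ℕ.<? h u) ℕ.+ 𝟙 (u Fin.≟ w))
      ≤⟨ sum-mono-≤ pointwise ⟩
    sum {n} (λ _ → 1)
      ≡⟨ trans (sum-const n 1) (ℕ.*-identityʳ n) ⟩
    n ∎
    where
    open ℕ.≤-Reasoning
    pointwise : ∀ w → 𝟙 (h w ℕ.<? h u) ℕ.+ 𝟙 (u Fin.≟ w) ℕ.≤ 1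
    -- `yes tt` is the trivially true event, whose indicator is the constant 1.
    pointwise w = 𝟙-+-≤ (h w ℕ.<? h u) (u Fin.≟ w) (yes tt) _ _
      (λ { hw<hu refl → ℕ.<-irrefl refl hw<hu })

  private
    -- Trichotomy for one ordered pair. A tie between distinct elements scores 0, which is what the
    -- equality case detects.
    pairs : Fin n → Fin n → ℕ
    pairs u w = 𝟙 (h w ℕ.<? h u) ℕ.+ 𝟙 (h u ℕ.<? h w) ℕ.+ 𝟙 (u Fin.≟ w)

    pairs≤1 : ∀ u w → pairs u w ℕ.≤ 1
    pairs≤1 u w = ℕ.≤-trans
      (ℕ.+-monoˡ-≤ (𝟙 (u Fin.≟ w)) (𝟙-+-≤ (h w ℕ.<? h u) (h u ℕ.<? h w)
        ((h w ℕ.<? h u) ⊎-dec (h u ℕ.<? h w)) inj₁ inj₂ ℕ.<-asym))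
      (𝟙-+-≤ ((h w ℕ.<? h u) ⊎-dec (h u ℕ.<? h w)) (u Fin.≟ w) (yes tt) _ _
        λ { (inj₁ lt) refl → ℕ.<-irrefl refl lt ; (inj₂ lt) refl → ℕ.<-irrefl refl lt })

    -- By `≤below`, each copy of `sum h` is at most the number of pairs with `w` below `u`.
    -- Exchanging the summations in the second copy makes it count `u` below `w`, and `n` counts the
    -- diagonal.
    sum-pairs : sum h ℕ.+ sum h ℕ.+ n ℕ.≤ sum (λ u → sum (pairs u))
    sum-pairs = begin
      sum h ℕ.+ sum h ℕ.+ n
        ≤⟨ ℕ.+-monoˡ-≤ n (ℕ.+-mono-≤ ∑h≤ ∑h≤) ⟩
      sum (λ u → sum (λ w → lt w u)) ℕ.+ sum (λ u → sum (λ w → lt w u)) ℕ.+ n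
        ≡⟨ cong₂ (λ a b → sum (λ u → sum (λ w → lt w u)) ℕ.+ a ℕ.+ b)
             (∑ℕ.∑-comm (λ u w → lt w u))
             (trans (trans (sym (ℕ.*-identityʳ n)) (sym (sum-const n 1)))
                    (sym (∑ℕ.sum-cong-≗ {n} {λ u → sum (eq u)} {λ _ → 1} sum-𝟙≟))) ⟩
      sum (λ u → sum (λ w → lt w u)) ℕ.+ sum (λ u → sum (λ w → lt u w)) ℕ.+ sum (λ u → sum (eq u))
        ≡⟨ cong (ℕ._+ sum (λ u → sum (eq u)))
             (∑ℕ.∑-distrib-+ (λ u → sum (λ w → lt w u)) (λ u → sum (λ w → lt u w))) ⟨
      sum (λ u → sum (λ w → lt w u) ℕ.+ sum (λ w → lt u w)) ℕ.+ sum (λ u → sum (eq u))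
        ≡⟨ ∑ℕ.∑-distrib-+ (λ u → sum (λ w → lt w u) ℕ.+ sum (λ w → lt u w)) (λ u → sum (eq u)) ⟨
      sum (λ u → sum (λ w → lt w u) ℕ.+ sum (λ w → lt u w) ℕ.+ sum (eq u))
        ≡⟨ ∑ℕ.sum-cong-≗ (λ u → sym (trans
             (∑ℕ.∑-distrib-+ (λ w → lt w u ℕ.+ lt u w) (eq u))
             (cong (ℕ._+ sum (eq u)) (∑ℕ.∑-distrib-+ (λ w → lt w u) (λ w → lt u w))))) ⟩
      sum (λ u → sum (pairs u)) ∎
      where
      open ℕ.≤-Reasoning
      lt eq : Fin n → Fin n → ℕ
      lt w u = 𝟙 (h w ℕ.<? h u)
      eq u w = 𝟙 (u Fin.≟ w)
      ∑h≤ : sum h ℕ.≤ sum (λ u → sum (λ w → lt w u))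
      ∑h≤ = sum-mono-≤ (λ u → ≤below (h u) u ℕ.≤-refl)

    sum-1 : sum {n} (λ _ → sum {n} (λ _ → 1)) ≡ n ℕ.* n
    sum-1 = trans (∑ℕ.sum-cong-≗ {n} (λ _ → trans (sum-const n 1) (ℕ.*-identityʳ n))) (sum-const n n)

  sum-heights≤ : sum h ℕ.+ sum h ℕ.+ n ℕ.≤ n ℕ.* n
  sum-heights≤ = ℕ.≤-trans sum-pairs
    (ℕ.≤-trans (sum-mono-≤ (λ u → sum-mono-≤ (pairs≤1 u))) (ℕ.≤-reflexive sum-1))

  -- Equality leaves every `pairs u w` at its maximum 1, whereas distinct elements of equal height
  -- give 0.
  sum-heights-tight⇒injective : n ℕ.* n ℕ.≤ sum h ℕ.+ sum h ℕ.+ n →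
                                ∀ u w → h u ≡ h w → u ≡ w
  sum-heights-tight⇒injective tight u w hu≡hw with u Fin.≟ w
  ... | yes u≡w = u≡w
  ... | no  u≢w = contradiction (trans (sym pairs≡0) pairs≡1) λ ()
    where
    pairs≡1 : pairs u w ≡ 1
    -- Tightness passes from the double sum to each row, then from a row to each entry.
    pairs≡1 = sum-mono-≤-tight (pairs≤1 u)
      (ℕ.≤-reflexive (sym (sum-mono-≤-tight (λ u → sum-mono-≤ (pairs≤1 u))
        (ℕ.≤-trans (ℕ.≤-reflexive sum-1) (ℕ.≤-trans tight sum-pairs)) u))) w
    pairs≡0 : pairs u w ≡ 0
    pairs≡0 = cong₂ ℕ._+_
      (cong₂ ℕ._+_ (𝟙-no (h w ℕ.<? h u) (ℕ.<-irrefl (sym hu≡hw)))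
                   (𝟙-no (h u ℕ.<? h w) (ℕ.<-irrefl hu≡hw)))
      (𝟙-no (u Fin.≟ w) u≢w)

-- Pigeonhole, least witnesses and lists without repetition.

Fin-injective⇒surjective : ∀ {n} (f : Fin n → Fin n) → (∀ i j → f i ≡ f j → i ≡ j) →
                           ∀ j → ∃ λ i → f i ≡ j
Fin-injective⇒surjective {suc n} f inj j with Fin.any? (λ i → f i Fin.≟ j)
... | yes hit = hit
-- A missed `j` could be punched out of the codomain, leaving an injection of `suc n` elements into
-- `n`.
... | no  miss = contradiction
  (Fin.injective⇒≤ {f = λ i → punchOut (j≢f i)}
    (λ {i} {k} eq → inj i k (Fin.punchOut-injective (j≢f i) (j≢f k) eq)))
  (ℕ.<⇒≱ ℕ.≤-refl)
  where
  j≢f : ∀ i → j ≢ f i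
  j≢f i j≡fi = miss (i , sym j≡fi)

least : ∀ {P : ℕ → Set} → (∀ k → Dec (P k)) → ∀ k → P k →
        ∃ λ m → P m × (∀ j → P j → m ℕ.≤ j)
least P? zero p = 0 , p , λ _ _ → z≤n
least {P} P? (suc k) p with P? 0
... | yes p₀ = 0 , p₀ , λ _ _ → z≤n
... | no ¬p₀ with least (P? ∘ suc) k p
... | m , pm , min = suc m , pm , λ where
  zero    pj → contradiction pj ¬p₀
  (suc j) pj → s≤s (min j pj)

lookup-injective : ∀ {n} {xs : List (Fin n)} → Unique xs → ∀ i j → lookup xs i ≡ lookup xs j → i ≡ j
lookup-injective (_ ∷ _)    zero    zero    eq = refl
lookup-injective (x∉xs ∷ _) zero    (suc j) eq = contradiction eq (All.lookup x∉xs (∈-lookup j))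
lookup-injective (x∉xs ∷ _) (suc i) zero    eq = contradiction (sym eq) (All.lookup x∉xs (∈-lookup i))
lookup-injective (_ ∷ xs!)  (suc i) (suc j) eq = cong suc (lookup-injective xs! i j eq)

unique⇒length≤ : ∀ {n} {xs : List (Fin n)} → Unique xs → length xs ℕ.≤ n
unique⇒length≤ xs! = Fin.injective⇒≤ (λ {i} {j} → lookup-injective xs! i j)

-- An isomorphism to the star is pinned down only at the centre, so any bijection sending `c` to 0
-- will do.
move-to-0 : ∀ {n} (c : Fin n) → Σ (Fin n ↔ Fin n) λ f → toℕ (Inverse.to f c) ≡ 0
move-to-0 {suc n} c = Perm.transpose c zero , transposed
  where
  transposed : toℕ (Inverse.to (Perm.transpose c zero) c) ≡ 0
  transposed rewrite dec-true (c Fin.≟ c) refl = refl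

-- Distances and transmissions

module Distance {n} (G : Graph n) (connected : Connected G) where

  -- The last edge is exposed, because distances have a fixed start `v` and are analysed at the
  -- varying endpoint.
  Walk : ℕ → Fin n → Fin n → Set
  Walk zero    v u = v ≡ u
  Walk (suc k) v u = ∃ λ w → Walk k v w × Adj G w u

  walk? : ∀ v u k → Dec (Walk k v u)
  walk? v u zero    = v Fin.≟ u
  walk? v u (suc k) = Fin.any? (λ w → walk? v w k ×-dec adj? G w u)

  -- `Star` exposes its first edge and `Walk` its last, so the walk is reversed.
  star⇒walk : ∀ {v u} → Star (Adj G) u v → ∃ λ k → Walk k v u
  star⇒walk nil = 0 , refl
  star⇒walk (uw ◅ ws) with star⇒walk ws
  ... | k , walk = suc k , _ , walk , symm G uw

  shortest : ∀ v u → ∃ λ m → Walk m v u × (∀ j → Walk j v u → m ℕ.≤ j)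
  shortest v u with star⇒walk (connected u v)
  ... | k , walk = least (walk? v u) k walk

  dist : Fin n → Fin n → ℕ
  dist v u = proj₁ (shortest v u)

  dist≤ : ∀ {v u k} → Walk k v u → dist v u ℕ.≤ k
  dist≤ {v} {u} {k} walk = proj₂ (proj₂ (shortest v u)) k walk

  dist-refl : ∀ v → dist v v ≡ 0
  dist-refl v = ℕ.n≤0⇒n≡0 (dist≤ refl)

  dist≡0⇒≡ : ∀ {v u} → dist v u ≡ 0 → v ≡ u
  dist≡0⇒≡ {v} {u} eq = subst (λ k → Walk k v u) eq (proj₁ (proj₂ (shortest v u)))

  dist-step : ∀ v {w u} → Adj G w u → dist v u ℕ.≤ suc (dist v w)
  dist-step v {w} wu = dist≤ (w , proj₁ (proj₂ (shortest v w)) , wu)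

  -- Deleting the last edge of a shortest walk leaves a shortest walk; otherwise `dist-step` would
  -- give a shortcut to `u`.
  dist-pred : ∀ v u k → dist v u ≡ suc k → ∃ λ w → Adj G w u × dist v w ≡ k
  dist-pred v u k eq with subst (λ k → Walk k v u) eq (proj₁ (proj₂ (shortest v u)))
  ... | w , walk , wu = w , wu , ℕ.≤-antisym (dist≤ walk)
    (ℕ.≤-pred (ℕ.≤-trans (ℕ.≤-reflexive (sym eq)) (dist-step v wu)))

  module Lipschitz (f : Fin n → ℕ) (step : ∀ {w u} → Adj G w u → f u ℕ.≤ suc (f w)) where

    ≤dist+ : ∀ v u → f u ℕ.≤ dist v u ℕ.+ f v
    ≤dist+ v u = go (dist v u) u refl
      where
      go : ∀ k u → dist v u ≡ k → f u ℕ.≤ k ℕ.+ f v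
      go zero    u eq = ℕ.≤-reflexive (cong f (sym (dist≡0⇒≡ eq)))
      go (suc k) u eq with dist-pred v u k eq
      ... | w , wu , eq′ = ℕ.≤-trans (step wu) (s≤s (go k w eq′))

    ≤+dist : ∀ v u → f v ℕ.≤ f u ℕ.+ dist v u
    ≤+dist v u = go (dist v u) u refl
      where
      go : ∀ k u → dist v u ≡ k → f v ℕ.≤ f u ℕ.+ k
      go zero    u eq = ℕ.≤-reflexive (trans (cong f (dist≡0⇒≡ eq)) (sym (ℕ.+-identityʳ (f u))))
      go (suc k) u eq with dist-pred v u k eq
      ... | w , wu , eq′ = ℕ.≤-trans (go k w eq′)
        (ℕ.≤-trans (ℕ.+-monoˡ-≤ k (step (symm G wu))) (ℕ.≤-reflexive (sym (ℕ.+-suc (f u) k))))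

  transmission : Fin n → ℕ
  transmission v = sum (dist v)

  module Levels v = Gapless (dist v)
    (λ u k eq → proj₁ (dist-pred v u k eq) , proj₂ (proj₂ (dist-pred v u k eq)))

  -- The triangle inequality d(v,u) ≤ d(v,w) + d(u,w), summed over `w`. It is the Lipschitz estimate
  -- for `dist v`, read from `u`.
  n*dist≤ : ∀ v u → n ℕ.* dist v u ℕ.≤ transmission v ℕ.+ transmission u
  n*dist≤ v u = begin
    n ℕ.* dist v u
      ≡⟨ sum-const n (dist v u) ⟨
    sum {n} (λ _ → dist v u)
      ≤⟨ sum-mono-≤ (Lipschitz.≤+dist (dist v) (dist-step v) u) ⟩
    sum (λ w → dist v w ℕ.+ dist u w)
      ≡⟨ ∑ℕ.∑-distrib-+ (dist v) (dist u) ⟩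
    transmission v ℕ.+ transmission u ∎
    where open ℕ.≤-Reasoning

  -- `dist v` itself is the isomorphism: as an injection into `Fin n` it is a bijection. Neighbours
  -- have unequal distances that differ by at most 1; conversely, the predecessor of a vertex at
  -- distance k + 1 can only be the unique vertex at distance k.
  injective⇒≅path : ∀ v → (∀ u w → dist v u ≡ dist v w → u ≡ w) → G ≅ path n
  injective⇒≅path v inj = Perm.permutation to from to∘from from∘to , λ u w → mk⇔ (⇒ u w) (⇐ u w)
    where
    to : Fin n → Fin n
    to u = fromℕ< (Levels.height< v u)
    toℕ-to : ∀ u → toℕ (to u) ≡ dist v u
    toℕ-to u = Fin.toℕ-fromℕ< (Levels.height< v u)
    to-injective : ∀ u w → to u ≡ to w → u ≡ w
    to-injective u w eq = inj u w (trans (sym (toℕ-to u)) (trans (cong toℕ eq) (toℕ-to w)))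
    from : Fin n → Fin n
    from j = proj₁ (Fin-injective⇒surjective to to-injective j)
    to∘from : ∀ j → to (from j) ≡ j
    to∘from j = proj₂ (Fin-injective⇒surjective to to-injective j)
    from∘to : ∀ u → from (to u) ≡ u
    from∘to u = to-injective _ _ (to∘from (to u))
    consecutive : ∀ u w → Adj G u w → dist v w ℕ.≤ dist v u → dist v u ≡ suc (dist v w)
    consecutive u w uw w≤u = ℕ.≤-antisym (dist-step v (symm G uw))
      (ℕ.≤∧≢⇒< w≤u (λ eq → irrefl G (inj u w (sym eq)) uw))
    ⇒ : ∀ u w → Adj G u w → Adj (path n) (to u) (to w)
    ⇒ u w uw with ℕ.≤-total (dist v u) (dist v w)
    ... | inj₁ u≤w = inj₁ (trans (toℕ-to w) (trans (consecutive w u (symm G uw) u≤w) (cong suc (sym (toℕ-to u)))))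
    ... | inj₂ w≤u = inj₂ (trans (toℕ-to u) (trans (consecutive u w uw w≤u) (cong suc (sym (toℕ-to w)))))
    up : ∀ u w → toℕ (to w) ≡ suc (toℕ (to u)) → Adj G u w
    up u w eq with dist-pred v w (dist v u) (trans (sym (toℕ-to w)) (trans eq (cong suc (toℕ-to u))))
    ... | u′ , u′w , eq′ = subst (λ x → Adj G x w) (inj u′ u eq′) u′w
    ⇐ : ∀ u w → Adj (path n) (to u) (to w) → Adj G u w
    ⇐ u w (inj₁ eq) = up u w eq
    ⇐ u w (inj₂ eq) = symm G (up w u eq)

  -- The witness is the vertex at position 0. Positions change by 1 along edges, so they are at most
  -- the distances from it, and their sum is known from `sum-toℕ`.
  path-transmission : G ≅ path n → Fin n → ∃ λ v → n ℕ.* n ℕ.≤ transmission v ℕ.+ transmission v ℕ.+ n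
  path-transmission (f , adj⇔) v₀ = v , (begin
    n ℕ.* n                              ≡⟨ sum-toℕ n ⟨
    sum {n} toℕ ℕ.+ sum {n} toℕ ℕ.+ n    ≡⟨ cong (λ s → s ℕ.+ s ℕ.+ n) (∑ℕ.sum-permute toℕ f) ⟩
    sum h ℕ.+ sum h ℕ.+ n                ≤⟨ ℕ.+-monoˡ-≤ n (ℕ.+-mono-≤ ∑h≤ ∑h≤) ⟩
    transmission v ℕ.+ transmission v ℕ.+ n ∎)
    where
    open ℕ.≤-Reasoning
    first : ∀ {m} → Fin m → ∃ λ (z : Fin m) → toℕ z ≡ 0
    first {suc m} _ = zero , refl
    z = proj₁ (first v₀)
    v = Inverse.from f z
    h : Fin n → ℕ
    h u = toℕ (Inverse.to f u)
    hv≡0 : h v ≡ 0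
    hv≡0 = trans (cong toℕ (Inverse.inverseˡ f refl)) (proj₂ (first v₀))
    step : ∀ {w u} → Adj G w u → h u ℕ.≤ suc (h w)
    step {w} {u} wu with Equivalence.to (adj⇔ w u) wu
    ... | inj₁ eq = ℕ.≤-reflexive eq
    ... | inj₂ eq = ℕ.≤-trans (ℕ.n≤1+n _) (ℕ.≤-trans (ℕ.≤-reflexive (sym eq)) (ℕ.n≤1+n _))
    ∑h≤ : sum h ℕ.≤ transmission v
    ∑h≤ = sum-mono-≤ λ u → ℕ.≤-trans (Lipschitz.≤dist+ h step v u)
      (ℕ.≤-reflexive (trans (cong (dist v u ℕ.+_) hv≡0) (ℕ.+-identityʳ _)))

  -- Leaves, stars and their transmissions.

  triangle⇒cycle : ∀ {a b c} → Adj G a b → Adj G b c → Adj G c a → Cycle G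
  triangle⇒cycle {a} {b} {c} ab bc ca = a , b ∷ c ∷ [] , s≤s (s≤s z≤n) ,
    ((adj⇒≢ ab ∷ (adj⇒≢ ca ∘ sym) ∷ []) ∷ (adj⇒≢ bc ∷ []) ∷ [] ∷ []) ,
    (ab ∷ bc ∷ ca ∷ [-])
    where
    adj⇒≢ : ∀ {u w} → Adj G u w → u ≢ w
    adj⇒≢ uw refl = irrefl G refl uw

  neighbour : ∀ {u v} → u ≢ v → ∃ λ w → Adj G u w
  neighbour {u} {v} u≢v with connected u v
  ... | nil    = contradiction refl u≢v
  ... | uw ◅ _ = _ , uw

  IsLeafAt : Fin n → Fin n → Set
  IsLeafAt v c = Adj G v c × (∀ u → Adj G v u → u ≡ c)

  module Leaf {v c : Fin n} (leaf : IsLeafAt v c) where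

    private
      -- The corrections lift the two distances below 2, namely 0 at `v` and 1 at `c`, up to 2. They
      -- add up to the 3 of the leaf bound.
      bound : Fin n → ℕ
      bound u = dist v u ℕ.+ 2 ℕ.* 𝟙 (v Fin.≟ u) ℕ.+ 𝟙 (c Fin.≟ u)

      sum-bound : sum bound ≡ transmission v ℕ.+ 3
      sum-bound = begin
        sum bound
          ≡⟨ ∑ℕ.∑-distrib-+ (λ u → dist v u ℕ.+ 2 ℕ.* 𝟙 (v Fin.≟ u)) (λ u → 𝟙 (c Fin.≟ u)) ⟩
        sum (λ u → dist v u ℕ.+ 2 ℕ.* 𝟙 (v Fin.≟ u)) ℕ.+ sum (λ u → 𝟙 (c Fin.≟ u))
          ≡⟨ cong₂ ℕ._+_ (∑ℕ.∑-distrib-+ (dist v) (λ u → 2 ℕ.* 𝟙 (v Fin.≟ u))) (sum-𝟙≟ c) ⟩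
        transmission v ℕ.+ sum (λ u → 2 ℕ.* 𝟙 (v Fin.≟ u)) ℕ.+ 1
          ≡⟨ cong (λ s → transmission v ℕ.+ s ℕ.+ 1)
               (trans (sym (∑ℕ.*-distribˡ-sum 2 (λ u → 𝟙 (v Fin.≟ u)))) (cong (2 ℕ.*_) (sum-𝟙≟ v))) ⟩
        transmission v ℕ.+ 2 ℕ.+ 1
          ≡⟨ ℕ.+-assoc (transmission v) 2 1 ⟩
        transmission v ℕ.+ 3 ∎
        where open ≡-Reasoning

      2≤bound : ∀ u → 2 ℕ.≤ bound u
      2≤bound u with v Fin.≟ u | c Fin.≟ u | dist v u in eq
      ... | yes _   | _        | m = ℕ.m≤n⇒m≤n+o _ (ℕ.m≤n+m 2 m)
      ... | no v≢u  | _        | 0 = contradiction (dist≡0⇒≡ eq) v≢u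
      ... | no _    | yes _    | 1 = ℕ.≤-refl
      -- A vertex at distance 1 is a neighbour of the leaf, hence `c`.
      ... | no _    | no c≢u   | 1 with dist-pred v u 0 eq
      ...   | w , wu , eq′ with refl ← dist≡0⇒≡ eq′ = contradiction (sym (proj₂ leaf u wu)) c≢u
      2≤bound u | no _ | _ | suc (suc m) = s≤s (s≤s z≤n)

    leaf-transmission : n ℕ.* 2 ℕ.≤ transmission v ℕ.+ 3
    leaf-transmission = begin
      n ℕ.* 2            ≡⟨ sum-const n 2 ⟨
      sum {n} (λ _ → 2)  ≤⟨ sum-mono-≤ 2≤bound ⟩
      sum bound          ≡⟨ sum-bound ⟩
      transmission v ℕ.+ 3 ∎
      where open ℕ.≤-Reasoning

    -- Equality forces distance exactly 2 from `v` to every vertex other than `v` and `c`. The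
    -- middle vertex of a shortest walk is then a neighbour of `v`, hence `c`.
    leaf-transmission-tight : transmission v ℕ.+ 3 ℕ.≤ n ℕ.* 2 → ∀ u → u ≢ c → Adj G u c
    leaf-transmission-tight tight u u≢c with u Fin.≟ v
    ... | yes refl = proj₁ leaf
    ... | no  u≢v with dist-pred v u 1 dist≡2
      where
      dist≡2 : dist v u ≡ 2
      dist≡2 = sym (trans
        (sum-mono-≤-tight 2≤bound (ℕ.≤-trans (ℕ.≤-reflexive sum-bound)
          (ℕ.≤-trans tight (ℕ.≤-reflexive (sym (sum-const n 2))))) u)
        (trans (cong₂ (λ a b → dist v u ℕ.+ 2 ℕ.* a ℕ.+ b)
                  (𝟙-no (v Fin.≟ u) (u≢v ∘ sym)) (𝟙-no (c Fin.≟ u) (u≢c ∘ sym)))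
               (trans (ℕ.+-identityʳ _) (ℕ.+-identityʳ _))))
    ...   | w , wu , eq with dist-pred v w 0 eq
    ...     | v′ , v′w , eq′ with refl ← dist≡0⇒≡ eq′ with refl ← proj₂ leaf w v′w = symm G wu

  -- Two adjacent vertices other than `c` would form a triangle with it, so every edge meets `c`.
  centre⇒≅star : ¬ Cycle G → ∀ {c} → (∀ u → u ≢ c → Adj G u c) →
                 (f : Fin n ↔ Fin n) → toℕ (Inverse.to f c) ≡ 0 → G ≅ star n
  centre⇒≅star acyclic {c} all-adj f fc≡0 = f , λ u w → mk⇔ (⇒ u w) (⇐ u w)
    where
    to : Fin n → Fin n
    to = Inverse.to f
    to-centre : ∀ {u} → u ≡ c → toℕ (to u) ≡ 0
    to-centre refl = fc≡0
    from-centre : ∀ {u} → toℕ (to u) ≡ 0 → u ≡ c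
    from-centre eq = Injection.injective (Inverse⇒Injection f)
      (Fin.toℕ-injective (trans eq (sym fc≡0)))
    ⇒ : ∀ u w → Adj G u w → Adj (star n) (to u) (to w)
    ⇒ u w uw with u Fin.≟ c | w Fin.≟ c
    ... | yes refl | yes refl = contradiction uw (irrefl G refl)
    ... | yes u≡c  | no w≢c   = inj₁ (to-centre u≡c , w≢c ∘ from-centre)
    ... | no u≢c   | yes w≡c  = inj₂ (to-centre w≡c , u≢c ∘ from-centre)
    ... | no u≢c   | no w≢c   = contradiction (triangle⇒cycle uw (all-adj w w≢c) (symm G (all-adj u u≢c))) acyclic
    ⇐ : ∀ u w → Adj (star n) (to u) (to w) → Adj G u w
    ⇐ u w (inj₁ (u≡0 , w≢0)) = subst (λ x → Adj G x w) (sym (from-centre u≡0)) (symm G (all-adj w (w≢0 ∘ to-centre)))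
    ⇐ u w (inj₂ (w≡0 , u≢0)) = subst (Adj G u) (sym (from-centre w≡0)) (all-adj u (u≢0 ∘ to-centre))

  -- Distances in a star are at most 2; `v` itself falls short of 2 by 2, and a neighbour of `v` by
  -- at least 1.
  star-transmission : G ≅ star n → ∀ v w → v ≢ w → transmission v ℕ.+ 3 ℕ.≤ n ℕ.* 2
  star-transmission (f , adj⇔) v v′ v≢v′ with neighbour v≢v′
  ... | w , vw = begin
    transmission v ℕ.+ 3
      ≡⟨ cong (transmission v ℕ.+_) (cong₂ ℕ._+_ (cong (2 ℕ.*_) (sum-𝟙≟ v)) (sum-𝟙≟ w)) ⟨
    transmission v ℕ.+ (2 ℕ.* sum (λ u → 𝟙 (v Fin.≟ u)) ℕ.+ sum (λ u → 𝟙 (w Fin.≟ u)))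
      ≡⟨ cong (λ s → transmission v ℕ.+ (s ℕ.+ sum (λ u → 𝟙 (w Fin.≟ u))))
           (∑ℕ.*-distribˡ-sum 2 (λ u → 𝟙 (v Fin.≟ u))) ⟩
    transmission v ℕ.+ (sum (λ u → 2 ℕ.* 𝟙 (v Fin.≟ u)) ℕ.+ sum (λ u → 𝟙 (w Fin.≟ u)))
      ≡⟨ cong (transmission v ℕ.+_) (∑ℕ.∑-distrib-+ (λ u → 2 ℕ.* 𝟙 (v Fin.≟ u)) (λ u → 𝟙 (w Fin.≟ u))) ⟨
    transmission v ℕ.+ sum (λ u → 2 ℕ.* 𝟙 (v Fin.≟ u) ℕ.+ 𝟙 (w Fin.≟ u))
      ≡⟨ ∑ℕ.∑-distrib-+ (dist v) (λ u → 2 ℕ.* 𝟙 (v Fin.≟ u) ℕ.+ 𝟙 (w Fin.≟ u)) ⟨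
    sum (λ u → dist v u ℕ.+ (2 ℕ.* 𝟙 (v Fin.≟ u) ℕ.+ 𝟙 (w Fin.≟ u)))
      ≤⟨ sum-mono-≤ pointwise ⟩
    sum {n} (λ _ → 2)
      ≡⟨ sum-const n 2 ⟩
    n ℕ.* 2 ∎
    where
    open ℕ.≤-Reasoning
    IsCentre : Fin n → Set
    IsCentre u = toℕ (Inverse.to f u) ≡ 0
    adj⁻ : ∀ {u w} → Adj (star n) (Inverse.to f u) (Inverse.to f w) → Adj G u w
    adj⁻ {u} {w} = Equivalence.from (adj⇔ u w)
    dist≤1 : ∀ {u} → Adj G v u → dist v u ℕ.≤ 1
    dist≤1 vu = dist≤ (v , refl , vu)
    dist≤2 : ∀ u → v ≢ u → dist v u ℕ.≤ 2
    dist≤2 u v≢u with toℕ (Inverse.to f v) ℕ.≟ 0 | toℕ (Inverse.to f u) ℕ.≟ 0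
    ... | yes v≡0 | yes u≡0 = contradiction
      (Injection.injective (Inverse⇒Injection f) (Fin.toℕ-injective (trans v≡0 (sym u≡0)))) v≢u
    ... | yes v≡0 | no u≢0 = ℕ.m≤n⇒m≤1+n (dist≤1 (adj⁻ (inj₁ (v≡0 , u≢0))))
    ... | no v≢0 | yes u≡0 = ℕ.m≤n⇒m≤1+n (dist≤1 (adj⁻ (inj₂ (u≡0 , v≢0))))
    ... | no v≢0 | no u≢0 with Equivalence.to (adj⇔ v w) vw
    ...   | inj₁ (v≡0 , _) = contradiction v≡0 v≢0
    -- `v` is not the centre, so its neighbour `w` is, and `w` links `v` to `u`.
    ...   | inj₂ (w≡0 , _) = dist≤ (w , (v , refl , vw) , adj⁻ (inj₁ (w≡0 , u≢0)))
    pointwise : ∀ u → dist v u ℕ.+ (2 ℕ.* 𝟙 (v Fin.≟ u) ℕ.+ 𝟙 (w Fin.≟ u)) ℕ.≤ 2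
    pointwise u with v Fin.≟ u | w Fin.≟ u
    ... | yes refl | yes refl = contradiction vw (irrefl G refl)
    ... | yes refl | no _ rewrite dist-refl v = ℕ.≤-refl
    ... | no _ | yes refl = ℕ.+-monoˡ-≤ 1 (dist≤1 vw)
    ... | no v≢u | no _ = ℕ.≤-trans (ℕ.≤-reflexive (ℕ.+-identityʳ _)) (dist≤2 u v≢u)

  -- Existence of a leaf in a tree.

  private
    -- The path is cut off just after `u` and the edge from `u` to `z` is appended. The last
    -- component lets `ys` inherit freshness from `xs` when a vertex is put in front.
    close-walk : ∀ {z x u xs} → u ∈ xs → Adj G u z → Linked (Adj G) (x ∷ xs) → Unique (x ∷ xs) →
      ∃ λ ys → 1 ℕ.≤ length ys × Unique (x ∷ ys) × Linked (Adj G) (x ∷ (ys ∷ʳ z))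
             × (∀ {P : Fin n → Set} → All P xs → All P ys)
    close-walk {u = u} (here refl) uz (xu ∷ _) ((x≢u ∷ _) ∷ _) =
      u ∷ [] , s≤s z≤n , ((x≢u ∷ []) ∷ [] ∷ []) , (xu ∷ uz ∷ [-]) , λ { (pu ∷ _) → pu ∷ [] }
    close-walk {xs = y ∷ xs} (there u∈xs) uz (xy ∷ linked) ((x≢y ∷ x≢xs) ∷ unique)
      with close-walk u∈xs uz linked unique
    ... | ys , _ , unique′ , linked′ , prefix =
      y ∷ ys , s≤s z≤n , ((x≢y ∷ prefix x≢xs) ∷ unique′) , (xy ∷ linked′) , λ { (py ∷ pxs) → py ∷ prefix pxs }

  -- The edge from `u` back to `v` closes the stretch of path between them; as `w` lies strictly
  -- inside it, there are at least three vertices.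
  chord⇒cycle : ∀ {v w u vs} → u ∈ vs → Adj G v u →
                Linked (Adj G) (v ∷ w ∷ vs) → Unique (v ∷ w ∷ vs) → Cycle G
  chord⇒cycle {v} {w} u∈vs vu (vw ∷ linked) ((v≢w ∷ v≢vs) ∷ unique)
    with close-walk u∈vs (symm G vu) linked unique
  ... | ys , 1≤ , unique′ , linked′ , prefix =
    v , w ∷ ys , s≤s 1≤ , ((v≢w ∷ prefix v≢vs) ∷ unique′) , (vw ∷ linked′)

  -- The path grows at its head `v` until `w` is the only neighbour of `v`: a neighbour in `vs`
  -- would close a cycle, and any other one lengthens the path. `k` is fuel; at 0 the path would
  -- have more than `n` distinct vertices.
  extend-to-leaf : ¬ Cycle G → ∀ k v w vs → n ℕ.< k ℕ.+ length (v ∷ w ∷ vs) →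
                   Linked (Adj G) (v ∷ w ∷ vs) → Unique (v ∷ w ∷ vs) → ∃ λ v → ∃ λ c → IsLeafAt v c
  extend-to-leaf acyclic zero v w vs n<len linked unique =
    contradiction (unique⇒length≤ unique) (ℕ.<⇒≱ n<len)
  extend-to-leaf acyclic (suc k) v w vs n<len linked@(vw ∷ _) unique
    with Fin.any? (λ u → adj? G v u ×-dec ¬? (u Fin.≟ w))
  ... | no ¬other = v , w , vw , λ u vu → decidable-stable (u Fin.≟ w) (λ u≢w → ¬other (u , vu , u≢w))
  ... | yes (u , vu , u≢w) with u ∈? vs
  ...   | yes u∈vs = contradiction (chord⇒cycle u∈vs vu linked unique) acyclic
  ...   | no  u∉vs = extend-to-leaf acyclic k u v (w ∷ vs)
    (subst (n ℕ.<_) (sym (ℕ.+-suc k _)) n<len)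
    (symm G vu ∷ linked)
    (((λ { refl → irrefl G refl vu }) ∷ u≢w ∷ ¬Any⇒All¬ vs u∉vs) ∷ unique)

  tree⇒leaf : ¬ Cycle G → ∀ v w → v ≢ w → ∃ λ v → ∃ λ c → IsLeafAt v c
  tree⇒leaf acyclic v w v≢w with neighbour v≢w
  ... | c , vc = extend-to-leaf acyclic n v c [] (ℕ.m<m+n n (s≤s z≤n)) (vc ∷ [-])
    (((λ { refl → irrefl G refl vc }) ∷ []) ∷ [] ∷ [])

-- Rationals and reals

fraction-mono : ∀ a b c d .{{_ : ℕ.NonZero b}} .{{_ : ℕ.NonZero d}} →
                a ℕ.* d ℕ.≤ c ℕ.* b → (+ a ℚ./ b) ℚ.≤ (+ c ℚ./ d)
-- `_/_` reduces to lowest terms, so the comparison is made on unreduced fractions.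
fraction-mono a b@(suc b-1) c d@(suc d-1) ad≤cb = ℚ.toℚᵘ-cancel-≤ (begin
  ℚ.toℚᵘ (+ a ℚ./ b)  ≃⟨ ℚ.toℚᵘ-fromℚᵘ (ℚᵘ.mkℚᵘ (+ a) b-1) ⟩
  ℚᵘ.mkℚᵘ (+ a) b-1   ≤⟨ ℚᵘ.*≤* (subst₂ ℤ._≤_ (ℤ.pos-* a d) (ℤ.pos-* c b) (ℤ.+≤+ ad≤cb)) ⟩
  ℚᵘ.mkℚᵘ (+ c) d-1   ≃⟨ ℚ.toℚᵘ-fromℚᵘ (ℚᵘ.mkℚᵘ (+ c) d-1) ⟨
  ℚ.toℚᵘ (+ c ℚ./ d)  ∎)
  where open ℚᵘ.≤-Reasoning

fraction-cong : ∀ a b c d .{{_ : ℕ.NonZero b}} .{{_ : ℕ.NonZero d}} →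
                a ℕ.* d ≡ c ℕ.* b → (+ a ℚ./ b) ≡ (+ c ℚ./ d)
fraction-cong a b c d eq = ℚ.≤-antisym
  (fraction-mono a b c d (ℕ.≤-reflexive eq)) (fraction-mono c d a b (ℕ.≤-reflexive (sym eq)))

fraction-injective : ∀ a b c d .{{_ : ℕ.NonZero b}} .{{_ : ℕ.NonZero d}} →
                     (+ a ℚ./ b) ≡ (+ c ℚ./ d) → a ℕ.* d ≡ c ℕ.* b
fraction-injective a b@(suc b-1) c d@(suc d-1) eq
  with ℚ./-injective-≃ (ℚᵘ.mkℚᵘ (+ a) b-1) (ℚᵘ.mkℚᵘ (+ c) d-1) eq
... | ℚᵘ.*≡* e = ℤ.+-injective (trans (ℤ.pos-* a d) (trans e (sym (ℤ.pos-* c b))))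

ι : ℕ → ℚ
ι m = + m ℚ./ 1

ι-mono : ∀ {m n} → m ℕ.≤ n → ι m ℚ.≤ ι n
ι-mono {m} {n} m≤n = fraction-mono m 1 n 1 (ℕ.*-monoˡ-≤ 1 m≤n)

toℚᵘ-ι : ∀ m → ℚ.toℚᵘ (ι m) ℚᵘ.≃ ℚᵘ.mkℚᵘ (+ m) 0
toℚᵘ-ι m = ℚ.toℚᵘ-fromℚᵘ (ℚᵘ.mkℚᵘ (+ m) 0)

ι-+ : ∀ m n → ι (m ℕ.+ n) ≡ ι m ℚ.+ ι n
ι-+ m n = ℚ.toℚᵘ-injective (begin-equality
  ℚ.toℚᵘ (ι (m ℕ.+ n))                     ≃⟨ toℚᵘ-ι (m ℕ.+ n) ⟩
  ℚᵘ.mkℚᵘ (+ (m ℕ.+ n)) 0                  ≃⟨ ℚᵘ.*≡* (cong (ℤ._* + 1) (trans (ℤ.pos-+ m n)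
                                               (sym (cong₂ ℤ._+_ (ℤ.*-identityʳ (+ m)) (ℤ.*-identityʳ (+ n)))))) ⟩
  ℚᵘ.mkℚᵘ (+ m) 0 ℚᵘ.+ ℚᵘ.mkℚᵘ (+ n) 0     ≃⟨ ℚᵘ.+-cong (toℚᵘ-ι m) (toℚᵘ-ι n) ⟨
  ℚ.toℚᵘ (ι m) ℚᵘ.+ ℚ.toℚᵘ (ι n)           ≃⟨ ℚ.toℚᵘ-homo-+ (ι m) (ι n) ⟨
  ℚ.toℚᵘ (ι m ℚ.+ ι n)                     ∎)
  where open ℚᵘ.≤-Reasoning

ι-suc : ∀ m → ι (suc m) ≡ 1ℚ ℚ.+ ι m
ι-suc = ι-+ 1

ι-* : ∀ m n → ι (m ℕ.* n) ≡ ι m ℚ.* ι n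
ι-* zero    n = sym (ℚ.*-zeroˡ (ι n))
ι-* (suc m) n = begin
  ι (n ℕ.+ m ℕ.* n)      ≡⟨ ι-+ n (m ℕ.* n) ⟩
  ι n ℚ.+ ι (m ℕ.* n)    ≡⟨ cong (ι n ℚ.+_) (ι-* m n) ⟩
  ι n ℚ.+ ι m ℚ.* ι n    ≡⟨ solve 2 (λ m n → n :+ m :* n := (con 1ℚ :+ m) :* n) refl (ι m) (ι n) ⟩
  (1ℚ ℚ.+ ι m) ℚ.* ι n   ≡⟨ cong (ℚ._* ι n) (ι-suc m) ⟨
  ι (suc m) ℚ.* ι n      ∎
  where open ≡-Reasoning

ι-nonNeg : ∀ m → ℚ.NonNegative (ι m)
ι-nonNeg m = ℚ.nonNegative (ι-mono {0} {m} z≤n)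

ι-pos : ∀ m .{{_ : ℕ.NonZero m}} → ℚ.Positive (ι m)
ι-pos m = ℚ.positive (ℚ.<-≤-trans (ℚ.positive⁻¹ 1ℚ) (ι-mono {1} {m} (ℕ.>-nonZero⁻¹ m)))

fraction-*-ι : ∀ a b .{{_ : ℕ.NonZero b}} → (+ a ℚ./ b) ℚ.* ι b ≡ ι a
fraction-*-ι a b@(suc b-1) = ℚ.toℚᵘ-injective (begin-equality
  ℚ.toℚᵘ ((+ a ℚ./ b) ℚ.* ι b)               ≃⟨ ℚ.toℚᵘ-homo-* (+ a ℚ./ b) (ι b) ⟩
  ℚ.toℚᵘ (+ a ℚ./ b) ℚᵘ.* ℚ.toℚᵘ (ι b)       ≃⟨ ℚᵘ.*-cong (ℚ.toℚᵘ-fromℚᵘ (ℚᵘ.mkℚᵘ (+ a) b-1)) (toℚᵘ-ι b) ⟩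
  ℚᵘ.mkℚᵘ (+ a) b-1 ℚᵘ.* ℚᵘ.mkℚᵘ (+ b) 0     ≃⟨ ℚᵘ.*≡* (trans (ℤ.*-identityʳ (+ a ℤ.* + b))
                                                   (cong (λ k → + a ℤ.* + k) (sym (ℕ.*-identityʳ b)))) ⟩
  ℚᵘ.mkℚᵘ (+ a) 0                            ≃⟨ toℚᵘ-ι a ⟨
  ℚ.toℚᵘ (ι a)                               ∎)
  where open ℚᵘ.≤-Reasoning

p-q≤r⇒p≤q+r : ∀ {p q r} → p ℚ.- q ℚ.≤ r → p ℚ.≤ q ℚ.+ r
p-q≤r⇒p≤q+r {p} {q} {r} h = subst (ℚ._≤ q ℚ.+ r)
  (solve 2 (λ p q → q :+ (p :- q) := p) refl p q) (ℚ.+-monoʳ-≤ q h)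

p≤q+r⇒p-q≤r : ∀ {p q r} → p ℚ.≤ q ℚ.+ r → p ℚ.- q ℚ.≤ r
p≤q+r⇒p-q≤r {p} {q} {r} h = subst (p ℚ.- q ℚ.≤_)
  (solve 2 (λ q r → q :+ r :- q := r) refl q r) (ℚ.+-monoˡ-≤ (ℚ.- q) h)

p≤∣p∣ : ∀ p → p ℚ.≤ ℚ.∣ p ∣
p≤∣p∣ p with ℚ.≤-total 0ℚ p
... | inj₁ 0≤p = ℚ.≤-reflexive (sym (ℚ.0≤p⇒∣p∣≡p 0≤p))
... | inj₂ p≤0 = ℚ.≤-trans p≤0 (ℚ.0≤∣p∣ p)

-p≤∣p∣ : ∀ p → ℚ.- p ℚ.≤ ℚ.∣ p ∣
-p≤∣p∣ p = subst (ℚ.- p ℚ.≤_) (ℚ.∣-p∣≡∣p∣ p) (p≤∣p∣ (ℚ.- p))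

fromℚ-mono : ∀ {p q} → p ℚ.≤ q → fromℚ p ≤ fromℚ q
fromℚ-mono {p} {q} p≤q ε 0<ε = 0 , λ _ _ →
  ℚ.≤-trans p≤q (subst (ℚ._≤ q ℚ.+ ε) (ℚ.+-identityʳ q) (ℚ.+-monoʳ-≤ q (ℚ.<⇒≤ 0<ε)))

≡⇒≃ : ∀ {x y} → (∀ k → seq x k ≡ seq y k) → x ≃ y
≡⇒≃ {x} {y} eq ε 0<ε = 0 , λ k _ → ℚ.≤-trans
  (ℚ.≤-reflexive (cong ℚ.∣_∣ (trans (cong (ℚ._- seq y k) (eq k)) (ℚ.+-inverseʳ (seq y k)))))
  (ℚ.<⇒≤ 0<ε)

≤-antisym : ∀ {x y} → x ≤ y → y ≤ x → x ≃ y
≤-antisym {x} {y} x≤y y≤x ε 0<ε with x≤y ε 0<ε | y≤x ε 0<ε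
... | M , p | N , q = M ℕ.⊔ N , λ k M⊔N≤k → bound (seq x k) (seq y k)
  (p k (ℕ.m⊔n≤o⇒m≤o M N M⊔N≤k)) (q k (ℕ.m⊔n≤o⇒n≤o M N M⊔N≤k))
  where
  bound : ∀ a b → a ℚ.≤ b ℚ.+ ε → b ℚ.≤ a ℚ.+ ε → ℚ.∣ a ℚ.- b ∣ ℚ.≤ ε
  bound a b a≤ b≤ with ℚ.∣p∣≡p∨∣p∣≡-p (a ℚ.- b)
  ... | inj₁ e = subst (ℚ._≤ ε) (sym e) (p≤q+r⇒p-q≤r a≤)
  ... | inj₂ e = subst (ℚ._≤ ε) (sym (trans e (solve 2 (λ a b → :- (a :- b) := b :- a) refl a b)))
                   (p≤q+r⇒p-q≤r b≤)

-- If ∣p - q∣ were positive, an `ε` strictly between 0 and it would refute closeness.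
fromℚ-injective : ∀ {p q} → fromℚ p ≃ fromℚ q → p ≡ q
fromℚ-injective {p} {q} p≃q with ℚ.∣ p ℚ.- q ∣ ℚ.≤? 0ℚ
... | yes ≤0 = begin
  p                    ≡⟨ solve 2 (λ p q → p := (p :- q) :+ q) refl p q ⟩
  (p ℚ.- q) ℚ.+ q      ≡⟨ cong (ℚ._+ q) (ℚ.∣p∣≡0⇒p≡0 (p ℚ.- q) (ℚ.≤-antisym ≤0 (ℚ.0≤∣p∣ (p ℚ.- q)))) ⟩
  0ℚ ℚ.+ q             ≡⟨ ℚ.+-identityˡ q ⟩
  q                    ∎
  where open ≡-Reasoning
... | no ≰0 with ℚ.<-dense (ℚ.≰⇒> ≰0)
... | ε , 0<ε , ε<∣p-q∣ with p≃q ε 0<ε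
... | N , close = contradiction refl (ℚ.<⇒≢ (ℚ.<-≤-trans ε<∣p-q∣ (close N ℕ.≤-refl)))

-- Both max₀ and ∣_∣ are built from _⊔_, which selects one of its arguments at each index.
⊔-elim : ∀ (P : ℚ → Set) {p q} → P p → P q → P (p ℚ.⊔ q)
⊔-elim P {p} {q} Pp Pq with ℚ.⊔-sel p q
... | inj₁ eq = subst P (sym eq) Pp
... | inj₂ eq = subst P (sym eq) Pq

max₀-elim : ∀ {A : Set} (P : ℚ → Set) (f : A → ℝ) xs k → P 0ℚ →
            (∀ {x} → x ∈ xs → P (seq (f x) k)) → P (seq (max₀ (map f xs)) k)
max₀-elim P f []       k P0 Pf = P0
max₀-elim P f (x ∷ xs) k P0 Pf = ⊔-elim P (Pf (here refl)) (max₀-elim P f xs k P0 (Pf ∘ there))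

0≤max₀ : ∀ {A : Set} (f : A → ℝ) xs k → 0ℚ ℚ.≤ seq (max₀ (map f xs)) k
0≤max₀ f []       k = ℚ.≤-refl
0≤max₀ f (x ∷ xs) k = ℚ.≤-trans (0≤max₀ f xs k) (ℚ.p≤q⊔p (seq (f x) k) (seq (max₀ (map f xs)) k))

≤max₀ : ∀ {A : Set} (f : A → ℝ) {x} {xs} k → x ∈ xs → seq (f x) k ℚ.≤ seq (max₀ (map f xs)) k
≤max₀ f {x} {_ ∷ xs} k (here refl)  = ℚ.p≤p⊔q (seq (f x) k) (seq (max₀ (map f xs)) k)
≤max₀ f {x} {y ∷ xs} k (there x∈xs) =
  ℚ.≤-trans (≤max₀ f k x∈xs) (ℚ.p≤q⊔p (seq (f y) k) (seq (max₀ (map f xs)) k))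

-- This holds exactly at each index, so the estimates on real vectors become estimates on rationals
-- at a fixed `k`. Limits enter only through membership in `𝓕`.
edge-gap : ∀ {n} (G : Graph n) x k {u w} → Adj G u w →
           seq (x u) k ℚ.- seq (x w) k ℚ.≤ seq (γ[ x ] G) k
edge-gap G x k {u} {w} uw = ℚ.≤-trans (ℚ.p≤p⊔q _ _)
  (≤max₀ (λ (u , v) → ∣ x u - x v ∣) k
    (∈-filter⁺ (uncurry (adj? G)) (∈-cartesianProduct⁺ (∈-allFin u) (∈-allFin w)) uw))

γ≤ : ∀ {n} (G : Graph n) x k {c} → 0ℚ ℚ.≤ c →
     (∀ {u w} → Adj G u w → seq (x u) k ℚ.- seq (x w) k ℚ.≤ c) → seq (γ[ x ] G) k ℚ.≤ c
γ≤ {n} G x k {c} 0≤c gap≤c = max₀-elim (ℚ._≤ c) _ (edges G) k 0≤c λ {(u , w)} uw∈ →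
  let uw = proj₂ (∈-filter⁻ (uncurry (adj? G)) {xs = cartesianProduct (allFin n) (allFin n)} uw∈) in
  ⊔-elim (ℚ._≤ c) (gap≤c uw)
    (subst (ℚ._≤ c) (solve 2 (λ a b → a :- b := :- (b :- a)) refl (seq (x w) k) (seq (x u) k))
      (gap≤c (symm G uw)))

-- With `a` the value at a vertex and `h` the distances from it, the sum of `h` becomes the
-- transmission.
∑-lower : ∀ {n} (x : Vector ℝ n) k a c (h : Vector ℕ n) →
          (∀ u → a ℚ.≤ seq (x u) k ℚ.+ c ℚ.* ι (h u)) →
          ι n ℚ.* a ℚ.≤ seq (∑ x) k ℚ.+ c ℚ.* ι (sum h)
∑-lower {zero}  x k a c h a≤ = ℚ.≤-reflexive
  (solve 2 (λ a c → con 0ℚ :* a := con 0ℚ :+ c :* con 0ℚ) refl a c)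
∑-lower {suc n} x k a c h a≤ = begin
  ι (suc n) ℚ.* a
    ≡⟨ cong (ℚ._* a) (ι-suc n) ⟩
  (1ℚ ℚ.+ ι n) ℚ.* a
    ≡⟨ solve 2 (λ n a → (con 1ℚ :+ n) :* a := a :+ n :* a) refl (ι n) a ⟩
  a ℚ.+ ι n ℚ.* a
    ≤⟨ ℚ.+-mono-≤ (a≤ zero) (∑-lower (x ∘ suc) k a c (h ∘ suc) (a≤ ∘ suc)) ⟩
  (x₀ ℚ.+ c ℚ.* ι (h zero)) ℚ.+ (s ℚ.+ c ℚ.* ι (sum (h ∘ suc)))
    ≡⟨ solve 5 (λ x h₀ s h c → (x :+ c :* h₀) :+ (s :+ c :* h) := (x :+ s) :+ c :* (h₀ :+ h)) refl
         x₀ (ι (h zero)) s (ι (sum (h ∘ suc))) c ⟩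
  (x₀ ℚ.+ s) ℚ.+ c ℚ.* (ι (h zero) ℚ.+ ι (sum (h ∘ suc)))
    ≡⟨ cong (λ t → (x₀ ℚ.+ s) ℚ.+ c ℚ.* t) (ι-+ (h zero) (sum (h ∘ suc))) ⟨
  (x₀ ℚ.+ s) ℚ.+ c ℚ.* ι (sum h) ∎
  where
  open ℚ.≤-Reasoning
  x₀ = seq (x zero) k
  s  = seq (∑ (x ∘ suc)) k

∑-affine : ∀ {n} c (h : Vector ℕ n) k →
           seq (∑ (λ u → fromℚ (1ℚ ℚ.- c ℚ.* ι (h u)))) k ≡ ι n ℚ.- c ℚ.* ι (sum h)
∑-affine {zero}  c h k = solve 1 (λ c → con 0ℚ := con 0ℚ :- c :* con 0ℚ) refl c
∑-affine {suc n} c h k = begin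
  (1ℚ ℚ.- c ℚ.* ι (h zero)) ℚ.+ seq (∑ (λ u → fromℚ (1ℚ ℚ.- c ℚ.* ι (h (suc u))))) k
    ≡⟨ cong ((1ℚ ℚ.- c ℚ.* ι (h zero)) ℚ.+_) (∑-affine c (h ∘ suc) k) ⟩
  (1ℚ ℚ.- c ℚ.* ι (h zero)) ℚ.+ (ι n ℚ.- c ℚ.* ι (sum (h ∘ suc)))
    ≡⟨ solve 4 (λ c h₀ n h → (con 1ℚ :- c :* h₀) :+ (n :- c :* h) := (con 1ℚ :+ n) :- c :* (h₀ :+ h)) refl
         c (ι (h zero)) (ι n) (ι (sum (h ∘ suc))) ⟩
  (1ℚ ℚ.+ ι n) ℚ.- c ℚ.* (ι (h zero) ℚ.+ ι (sum (h ∘ suc)))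
    ≡⟨ cong₂ (λ a b → a ℚ.- c ℚ.* b) (ι-suc n) (ι-+ (h zero) (sum (h ∘ suc))) ⟨
  ι (suc n) ℚ.- c ℚ.* ι (sum h) ∎
  where open ≡-Reasoning

∑-neg : ∀ {n} (x : Vector ℝ n) k → seq (∑ (λ u → - x u)) k ≡ ℚ.- seq (∑ x) k
∑-neg {zero}  x k = refl
∑-neg {suc n} x k = trans (cong (ℚ.- seq (x zero) k ℚ.+_) (∑-neg (x ∘ suc) k))
  (sym (ℚ.neg-distrib-+ (seq (x zero) k) (seq (∑ (x ∘ suc)) k)))

-- γ as the reciprocal of the mean distance from a vertex of maximal transmission

module Gamma {n} (G : Graph n) (connected : Connected G) where
  open Distance G connected

  lipschitzℚ : ∀ (y : Fin n → ℚ) c → (∀ {u w} → Adj G u w → y u ℚ.≤ y w ℚ.+ c) →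
               ∀ v u → y v ℚ.≤ y u ℚ.+ c ℚ.* ι (dist v u)
  lipschitzℚ y c gap≤c v u = go (dist v u) u refl
    where
    go : ∀ k u → dist v u ≡ k → y v ℚ.≤ y u ℚ.+ c ℚ.* ι k
    go zero    u eq with refl ← dist≡0⇒≡ eq =
      ℚ.≤-reflexive (solve 2 (λ y c → y := y :+ c :* con 0ℚ) refl (y v) c)
    go (suc k) u eq with dist-pred v u k eq
    ... | w , wu , eq′ = begin
      y v                                   ≤⟨ go k w eq′ ⟩
      y w ℚ.+ c ℚ.* ι k                     ≤⟨ ℚ.+-monoˡ-≤ (c ℚ.* ι k) (gap≤c wu) ⟩
      (y u ℚ.+ c) ℚ.+ c ℚ.* ι k             ≡⟨ solve 3 (λ y c k → (y :+ c) :+ c :* k := y :+ c :* (con 1ℚ :+ k)) refl (y u) c (ι k) ⟩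
      y u ℚ.+ c ℚ.* (1ℚ ℚ.+ ι k)            ≡⟨ cong (λ t → y u ℚ.+ c ℚ.* t) (ι-suc k) ⟨
      y u ℚ.+ c ℚ.* ι (suc k)               ∎
      where open ℚ.≤-Reasoning

  -- `g` is n / D, given by the equation `g*ιD` so that inequalities can be proved after
  -- multiplication by `ι D`.
  module Maximal (v : Fin n) (maximal : ∀ u → transmission u ℕ.≤ transmission v)
                 {{nonZero : ℕ.NonZero (transmission v)}}
                 (g : ℚ) (g*ιD : g ℚ.* ι (transmission v) ≡ ι n) where

    D : ℕ
    D = transmission v

    instance
      ιD-pos : ℚ.Positive (ι D)
      ιD-pos = ι-pos D
      ιD-nonNeg : ℚ.NonNegative (ι D)
      ιD-nonNeg = ι-nonNeg D

    0≤g : 0ℚ ℚ.≤ g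
    0≤g = ℚ.*-cancelʳ-≤-pos (ι D) (begin
      0ℚ ℚ.* ι D  ≡⟨ ℚ.*-zeroˡ (ι D) ⟩
      0ℚ          ≤⟨ ι-mono {0} {n} z≤n ⟩
      ι n         ≡⟨ g*ιD ⟨
      g ℚ.* ι D   ∎)
      where open ℚ.≤-Reasoning

    instance
      g-nonNeg : ℚ.NonNegative g
      g-nonNeg = ℚ.nonNegative 0≤g

    module _ (x : Vector ℝ n) (k : ℕ) where
      private
        c s : ℚ
        c = seq (γ[ x ] G) k
        s = seq (∑ x) k

        0≤c : 0ℚ ℚ.≤ c
        0≤c = 0≤max₀ (λ (u , w) → ∣ x u - x w ∣) (edges G) k

        bound : ℚ
        bound = ℚ.∣ s ∣ ℚ.+ c ℚ.* ι D

        -- A general `z` allows use for both `x` and `- x`, which together bound `∣ x u ∣`.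
        potential-bound : ∀ (z : Vector ℝ n) → seq (∑ z) k ℚ.≤ ℚ.∣ s ∣ →
          (∀ {u w} → Adj G u w → seq (z u) k ℚ.≤ seq (z w) k ℚ.+ c) →
          ∀ u → ι n ℚ.* seq (z u) k ℚ.≤ bound
        potential-bound z ∑z≤ gap u = begin
          ι n ℚ.* seq (z u) k
            ≤⟨ ∑-lower z k (seq (z u) k) c (dist u) (lipschitzℚ (λ w → seq (z w) k) c gap u) ⟩
          seq (∑ z) k ℚ.+ c ℚ.* ι (transmission u)
            ≤⟨ ℚ.+-mono-≤ ∑z≤ (ℚ.*-monoˡ-≤-nonNeg c {{ℚ.nonNegative 0≤c}} (ι-mono (maximal u))) ⟩
          bound ∎
          where open ℚ.≤-Reasoning

      -- Valid for arbitrary `x` at every index, with the sum kept as an error term. For feasible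
      -- `x` it becomes n ≤ γ D in the limit.
      norm-bound : ι n ℚ.* seq ∥ x ∥∞ k ℚ.≤ ℚ.∣ seq (∑ x) k ∣ ℚ.+ seq (γ[ x ] G) k ℚ.* ι D
      norm-bound = max₀-elim (λ t → ι n ℚ.* t ℚ.≤ bound) _ (allFin n) k
        (begin
          ι n ℚ.* 0ℚ    ≡⟨ ℚ.*-zeroʳ (ι n) ⟩
          0ℚ ℚ.+ 0ℚ     ≡⟨ cong (0ℚ ℚ.+_) (ℚ.*-zeroˡ (ι D)) ⟨
          0ℚ ℚ.+ 0ℚ ℚ.* ι D  ≤⟨ ℚ.+-mono-≤ (ℚ.0≤∣p∣ s) (ℚ.*-monoʳ-≤-nonNeg (ι D) 0≤c) ⟩
          bound ∎)
        (λ {u} _ → ⊔-elim (λ t → ι n ℚ.* t ℚ.≤ bound)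
          (potential-bound x (p≤∣p∣ s) (λ uw → p-q≤r⇒p≤q+r (edge-gap G x k uw)) u)
          (potential-bound (λ w → - x w)
            (subst (ℚ._≤ ℚ.∣ s ∣) (sym (∑-neg x k)) (-p≤∣p∣ s))
            (λ {u} {w} uw → p-q≤r⇒p≤q+r (subst (ℚ._≤ c)
              (solve 2 (λ a b → b :- a := :- a :- (:- b)) refl (seq (x u) k) (seq (x w) k))
              (edge-gap G x k (symm G uw)))) u))
        where open ℚ.≤-Reasoning

    -- A feasible x has |∑ x| ≤ δ and ∥ x ∥∞ ≥ 1 − δ at late indices, which
    -- costs δ (n + 1) in norm-bound; hence the choice of δ.
    g-minimal : ∀ x → 𝓕 x → fromℚ g ≤ γ[ x ] G
    g-minimal x (∑x≃0 , ∥x∥≃1) ε 0<ε = M ℕ.⊔ N , λ k M⊔N≤k →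
      late k (∑-close k (ℕ.m⊔n≤o⇒m≤o M N M⊔N≤k)) (∥∥-close k (ℕ.m⊔n≤o⇒n≤o M N M⊔N≤k))
      where
      r δ : ℚ
      r = + 1 ℚ./ suc n
      δ = ε ℚ.* r
      0<r : 0ℚ ℚ.< r
      0<r = ℚ.*-cancelʳ-<-nonNeg (ι (suc n)) {{ι-nonNeg (suc n)}}
        (subst₂ ℚ._<_ (sym (ℚ.*-zeroˡ (ι (suc n)))) (sym (fraction-*-ι 1 (suc n))) (ℚ.positive⁻¹ 1ℚ))
      0<δ : 0ℚ ℚ.< δ
      0<δ = subst (ℚ._< δ) (ℚ.*-zeroʳ ε) (ℚ.*-monoʳ-<-pos ε {{ℚ.positive 0<ε}} 0<r)
      M = proj₁ (∑x≃0 δ 0<δ)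
      ∑-close = proj₂ (∑x≃0 δ 0<δ)
      N = proj₁ (∥x∥≃1 δ 0<δ)
      ∥∥-close = proj₂ (∥x∥≃1 δ 0<δ)
      late : ∀ k → ℚ.∣ seq (∑ x) k ℚ.- 0ℚ ∣ ℚ.≤ δ → ℚ.∣ seq ∥ x ∥∞ k ℚ.- 1ℚ ∣ ℚ.≤ δ →
             g ℚ.≤ seq (γ[ x ] G) k ℚ.+ ε
      late k ∣∑∣≤δ ∣∥∥-1∣≤δ = ℚ.*-cancelʳ-≤-pos (ι D) (begin
        g ℚ.* ι D
          ≡⟨ g*ιD ⟩
        ι n
          ≡⟨ solve 2 (λ n δ → n := n :* (con 1ℚ :- δ) :+ n :* δ) refl (ι n) δ ⟩
        ι n ℚ.* (1ℚ ℚ.- δ) ℚ.+ ι n ℚ.* δ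
          ≤⟨ ℚ.+-monoˡ-≤ (ι n ℚ.* δ) (ℚ.*-monoˡ-≤-nonNeg (ι n) {{ι-nonNeg n}} 1-δ≤) ⟩
        ι n ℚ.* seq ∥ x ∥∞ k ℚ.+ ι n ℚ.* δ
          ≤⟨ ℚ.+-monoˡ-≤ (ι n ℚ.* δ) (norm-bound x k) ⟩
        ℚ.∣ seq (∑ x) k ∣ ℚ.+ c ℚ.* ι D ℚ.+ ι n ℚ.* δ
          ≤⟨ ℚ.+-monoˡ-≤ (ι n ℚ.* δ) (ℚ.+-monoˡ-≤ (c ℚ.* ι D)
               (subst (λ t → ℚ.∣ t ∣ ℚ.≤ δ) (ℚ.+-identityʳ (seq (∑ x) k)) ∣∑∣≤δ)) ⟩
        δ ℚ.+ c ℚ.* ι D ℚ.+ ι n ℚ.* δ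
          ≡⟨ solve 5 (λ ε r c D n → ε :* r :+ c :* D :+ n :* (ε :* r) := c :* D :+ ε :* (r :* (con 1ℚ :+ n)))
               refl ε r c (ι D) (ι n) ⟩
        c ℚ.* ι D ℚ.+ ε ℚ.* (r ℚ.* (1ℚ ℚ.+ ι n))
          ≡⟨ cong (λ t → c ℚ.* ι D ℚ.+ ε ℚ.* t)
               (trans (cong (r ℚ.*_) (sym (ι-suc n))) (fraction-*-ι 1 (suc n))) ⟩
        c ℚ.* ι D ℚ.+ ε ℚ.* 1ℚ
          -- D is at least 1, so the error ε is at most ε D and the factor D can be cancelled.
          ≤⟨ ℚ.+-monoʳ-≤ (c ℚ.* ι D) (ℚ.*-monoˡ-≤-nonNeg ε {{ℚ.nonNegative (ℚ.<⇒≤ 0<ε)}}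
               (ι-mono {1} {D} (ℕ.>-nonZero⁻¹ D))) ⟩
        c ℚ.* ι D ℚ.+ ε ℚ.* ι D
          ≡⟨ ℚ.*-distribʳ-+ (ι D) c ε ⟨
        (c ℚ.+ ε) ℚ.* ι D ∎)
        where
        open ℚ.≤-Reasoning
        c = seq (γ[ x ] G) k
        t = seq ∥ x ∥∞ k
        1-δ≤ : 1ℚ ℚ.- δ ℚ.≤ t
        1-δ≤ = p≤q+r⇒p-q≤r {1ℚ} {δ} {t} (subst (ℚ._≤ δ ℚ.+ t)
          (solve 1 (λ t → :- (t :- con 1ℚ) :+ t := con 1ℚ) refl t)
          (ℚ.+-monoˡ-≤ t (ℚ.≤-trans (-p≤∣p∣ (t ℚ.- 1ℚ)) ∣∥∥-1∣≤δ)))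

    optimum : Vector ℝ n
    optimum u = fromℚ (1ℚ ℚ.- g ℚ.* ι (dist v u))

    g*dist≤2 : ∀ u → g ℚ.* ι (dist v u) ℚ.≤ 1ℚ ℚ.+ 1ℚ
    g*dist≤2 u = ℚ.*-cancelʳ-≤-pos (ι D) (begin
      g ℚ.* ι (dist v u) ℚ.* ι D
        ≡⟨ solve 3 (λ g d D → g :* d :* D := g :* D :* d) refl g (ι (dist v u)) (ι D) ⟩
      g ℚ.* ι D ℚ.* ι (dist v u)
        ≡⟨ cong (ℚ._* ι (dist v u)) g*ιD ⟩
      ι n ℚ.* ι (dist v u)
        ≡⟨ ι-* n (dist v u) ⟨
      ι (n ℕ.* dist v u)
        ≤⟨ ι-mono (ℕ.≤-trans (n*dist≤ v u) (ℕ.+-monoʳ-≤ D (maximal u))) ⟩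
      ι (D ℕ.+ D)
        ≡⟨ ι-+ D D ⟩
      ι D ℚ.+ ι D
        ≡⟨ solve 1 (λ D → D :+ D := (con 1ℚ :+ con 1ℚ) :* D) refl (ι D) ⟩
      (1ℚ ℚ.+ 1ℚ) ℚ.* ι D ∎)
      where open ℚ.≤-Reasoning

    ∥optimum∥≡1 : ∀ k → seq ∥ optimum ∥∞ k ≡ 1ℚ
    ∥optimum∥≡1 k = ℚ.≤-antisym
      (max₀-elim (ℚ._≤ 1ℚ) _ (allFin n) k (ℚ.<⇒≤ (ℚ.positive⁻¹ 1ℚ)) (λ {u} _ → ⊔-elim (ℚ._≤ 1ℚ)
        (p≤q+r⇒p-q≤r {1ℚ} {g ℚ.* ι (dist v u)} {1ℚ} (subst (ℚ._≤ g ℚ.* ι (dist v u) ℚ.+ 1ℚ) (ℚ.+-identityˡ 1ℚ)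
          (ℚ.+-monoˡ-≤ 1ℚ (0≤g* (dist v u)))))
        (subst (ℚ._≤ 1ℚ)
          (solve 1 (λ t → t :- con 1ℚ := :- (con 1ℚ :- t)) refl (g ℚ.* ι (dist v u)))
          (p≤q+r⇒p-q≤r {g ℚ.* ι (dist v u)} {1ℚ} {1ℚ} (g*dist≤2 u)))))
      -- The value 1 is attained at `v`, whose distance is 0.
      (begin
        1ℚ                             ≡⟨ solve 1 (λ g → con 1ℚ := con 1ℚ :- g :* con 0ℚ) refl g ⟩
        1ℚ ℚ.- g ℚ.* ι 0               ≡⟨ cong (λ d → 1ℚ ℚ.- g ℚ.* ι d) (dist-refl v) ⟨
        1ℚ ℚ.- g ℚ.* ι (dist v v)      ≤⟨ ℚ.p≤p⊔q _ _ ⟩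
        seq (∣ optimum v ∣) k          ≤⟨ ≤max₀ (λ u → ∣ optimum u ∣) k (∈-allFin v) ⟩
        seq ∥ optimum ∥∞ k             ∎)
      where
      open ℚ.≤-Reasoning
      0≤g* : ∀ d → 0ℚ ℚ.≤ g ℚ.* ι d
      0≤g* d = subst (ℚ._≤ g ℚ.* ι d) (ℚ.*-zeroʳ g) (ℚ.*-monoˡ-≤-nonNeg g (ι-mono {0} {d} z≤n))

    optimum∈𝓕 : 𝓕 optimum
    optimum∈𝓕 = ≡⇒≃ {∑ optimum} {0ℝ} (λ k → trans (∑-affine g (dist v) k)
                  (trans (cong (λ t → ι n ℚ.- t) g*ιD) (ℚ.+-inverseʳ (ι n))))
              , ≡⇒≃ {∥ optimum ∥∞} {1ℝ} ∥optimum∥≡1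

    γ[optimum]≤g : γ[ optimum ] G ≤ fromℚ g
    γ[optimum]≤g ε 0<ε = 0 , λ k _ → ℚ.≤-trans
      (γ≤ G optimum k 0≤g λ {u} {w} uw → p≤q+r⇒p-q≤r (begin
        1ℚ ℚ.- g ℚ.* ι (dist v u)
          ≡⟨ solve 2 (λ g d → con 1ℚ :- g :* d := con 1ℚ :- g :* (con 1ℚ :+ d) :+ g) refl g (ι (dist v u)) ⟩
        1ℚ ℚ.- g ℚ.* (1ℚ ℚ.+ ι (dist v u)) ℚ.+ g
          ≡⟨ cong (λ t → 1ℚ ℚ.- g ℚ.* t ℚ.+ g) (ι-suc (dist v u)) ⟨
        1ℚ ℚ.- g ℚ.* ι (suc (dist v u)) ℚ.+ g
          ≤⟨ ℚ.+-monoˡ-≤ g (ℚ.+-monoʳ-≤ 1ℚ (ℚ.neg-antimono-≤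
               (ℚ.*-monoˡ-≤-nonNeg g (ι-mono (dist-step v uw))))) ⟩
        1ℚ ℚ.- g ℚ.* ι (dist v w) ℚ.+ g ∎))
      (subst (ℚ._≤ g ℚ.+ ε) (ℚ.+-identityʳ g) (ℚ.+-monoʳ-≤ g (ℚ.<⇒≤ 0<ε)))
      where open ℚ.≤-Reasoning

    g-isGamma : fromℚ g IsGammaOf G
    g-isGamma = (optimum , optimum∈𝓕 ,
      ≤-antisym {γ[ optimum ] G} {fromℚ g} γ[optimum]≤g (g-minimal optimum optimum∈𝓕)) , g-minimal

-- The bounds for trees and their equality cases.

-- Here the gamma is a rational constant, so real comparisons with rational bounds reduce to
-- comparisons in ℚ.
rational-gamma : ∀ {n} {T : Graph n} {A B : Set} (g lb ub : ℚ) → fromℚ g IsGammaOf T →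
  lb ℚ.≤ g → g ℚ.≤ ub → g ≡ lb ⇔ A → g ≡ ub ⇔ B →
  ∃ λ (γ : ℝ) → γ IsGammaOf T × (fromℚ lb ≤ γ) × (γ ≤ fromℚ ub)
              × (γ ≃ fromℚ lb ⇔ A) × (γ ≃ fromℚ ub ⇔ B)
rational-gamma g lb ub isGamma lb≤g g≤ub g≡lb⇔A g≡ub⇔B =
  fromℚ g , isGamma , fromℚ-mono {lb} {g} lb≤g , fromℚ-mono {g} {ub} g≤ub ,
  mk⇔ (λ g≃lb → to g≡lb⇔A (fromℚ-injective {g} {lb} g≃lb)) (λ a → ≃⇐≡ (from g≡lb⇔A a)) ,
  mk⇔ (λ g≃ub → to g≡ub⇔B (fromℚ-injective {g} {ub} g≃ub)) (λ b → ≃⇐≡ (from g≡ub⇔B b))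
  where
  open Equivalence
  ≃⇐≡ : ∀ {p} → g ≡ p → fromℚ g ≃ fromℚ p
  ≃⇐≡ {p} g≡p = ≡⇒≃ {fromℚ g} {fromℚ p} (λ _ → g≡p)

another : ∀ {n} → 2 ℕ.≤ n → (u : Fin n) → ∃ λ w → u ≢ w
another (s≤s (s≤s z≤n)) zero    = suc zero , λ ()
another (s≤s (s≤s z≤n)) (suc _) = zero , λ ()

theorem4p8 : ∀ (n : ℕ) (n≥3 : 3 ℕ.≤ n) (T : Graph n) → IsTree T →
    ∃ λ (γ : ℝ) → γ IsGammaOf T
    × (fromℚ (lowerBound n n≥3) ≤ γ)
    × (γ ≤ fromℚ (upperBound n n≥3))
    × (γ ≃ fromℚ (lowerBound n n≥3) ⇔ T ≅ path n)
    × (γ ≃ fromℚ (upperBound n n≥3) ⇔ T ≅ star n)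
theorem4p8 n n≥3 T (connected , acyclic) = rational-gamma {T = T} g (lowerBound n n≥3) (upperBound n n≥3)
  g-isGamma lb≤g g≤ub (mk⇔ path⇐ path⇒) (mk⇔ star⇐ star⇒)
  where
  open Distance T connected
  n≥2 : 2 ℕ.≤ n
  n≥2 = ℕ.<⇒≤ n≥3
  v₀ v : Fin n
  v₀ = fromℕ< n≥3
  v = argmax transmission v₀ (allFin n)
  maximal : ∀ u → transmission u ℕ.≤ transmission v
  maximal u = All.lookup (f[xs]≤f[argmax] v₀ (allFin n)) (∈-allFin u)
  a-leaf : ∃ λ l → ∃ λ c → IsLeafAt l c
  a-leaf = tree⇒leaf acyclic v₀ _ (proj₂ (another n≥2 v₀))
  l c : Fin n
  l = proj₁ a-leaf
  c = proj₁ (proj₂ a-leaf)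
  leaf : IsLeafAt l c
  leaf = proj₂ (proj₂ a-leaf)
  leaf-bound : n ℕ.* 2 ℕ.≤ transmission v ℕ.+ 3
  leaf-bound = ℕ.≤-trans (Leaf.leaf-transmission leaf) (ℕ.+-monoˡ-≤ 3 (maximal l))
  2n∸3≤D : 2 ℕ.* n ℕ.∸ 3 ℕ.≤ transmission v
  2n∸3≤D = ℕ.m≤n+o⇒m∸n≤o (2 ℕ.* n) 3 (subst₂ ℕ._≤_ (ℕ.*-comm n 2) (ℕ.+-comm (transmission v) 3) leaf-bound)
  3<2n : 3 ℕ.< 2 ℕ.* n
  3<2n = ℕ.≤-trans (ℕ.m≤m+n 4 2) (ℕ.*-monoʳ-≤ 2 n≥3)
  instance
    n∸1-nonZero : ℕ.NonZero (n ℕ.∸ 1)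
    n∸1-nonZero = ℕ.>-nonZero (ℕ.m<n⇒0<n∸m n≥2)
    2n∸3-nonZero : ℕ.NonZero (2 ℕ.* n ℕ.∸ 3)
    2n∸3-nonZero = ℕ.>-nonZero (ℕ.m<n⇒0<n∸m 3<2n)
    D-nonZero : ℕ.NonZero (transmission v)
    D-nonZero = ℕ.>-nonZero (ℕ.<-≤-trans (ℕ.m<n⇒0<n∸m 3<2n) 2n∸3≤D)
  D : ℕ
  D = transmission v
  g : ℚ
  g = + n ℚ./ D
  open Gamma.Maximal T connected v maximal g (fraction-*-ι n D) using (g-isGamma)
  lb ub : ℚ
  lb = lowerBound n n≥3
  ub = upperBound n n≥3
  -- Both sides of 2 D ≤ n (n - 1) are compared after adding `n`, the form in which the level count
  -- is stated.
  2D+n : 2 ℕ.* D ℕ.+ n ≡ D ℕ.+ D ℕ.+ n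
  2D+n = cong (λ t → D ℕ.+ t ℕ.+ n) (ℕ.+-identityʳ D)
  n*n∸1+n : n ℕ.* (n ℕ.∸ 1) ℕ.+ n ≡ n ℕ.* n
  n*n∸1+n = trans (ℕ.+-comm _ n) (trans (sym (ℕ.*-suc n (n ℕ.∸ 1)))
    (cong (n ℕ.*_) (ℕ.m+[n∸m]≡n (ℕ.<⇒≤ n≥2))))
  2D≤ : 2 ℕ.* D ℕ.≤ n ℕ.* (n ℕ.∸ 1)
  2D≤ = ℕ.+-cancelʳ-≤ n _ _ (subst₂ ℕ._≤_ (sym 2D+n) (sym n*n∸1+n) (Levels.sum-heights≤ v))
  lb≤g : lb ℚ.≤ g
  lb≤g = fraction-mono 2 (n ℕ.∸ 1) n D 2D≤
  g≤ub : g ℚ.≤ ub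
  g≤ub = fraction-mono n D n (2 ℕ.* n ℕ.∸ 3) (ℕ.*-monoʳ-≤ n 2n∸3≤D)
  path⇐ : g ≡ lb → T ≅ path n
  path⇐ g≡lb = injective⇒≅path v (Levels.sum-heights-tight⇒injective v (ℕ.≤-reflexive (begin
    n ℕ.* n                  ≡⟨ n*n∸1+n ⟨
    n ℕ.* (n ℕ.∸ 1) ℕ.+ n    ≡⟨ cong (ℕ._+ n) (fraction-injective n D 2 (n ℕ.∸ 1) g≡lb) ⟩
    2 ℕ.* D ℕ.+ n            ≡⟨ 2D+n ⟩
    D ℕ.+ D ℕ.+ n            ∎)))
    where open ≡-Reasoning
  path⇒ : T ≅ path n → g ≡ lb
  path⇒ T≅P =
    -- An end of the path has transmission at least n (n - 1) / 2, and D dominates it.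
    let u , n²≤2u = path-transmission T≅P v₀ in
    fraction-cong n D 2 (n ℕ.∸ 1) (ℕ.≤-antisym
      (ℕ.+-cancelʳ-≤ n _ _ (subst₂ ℕ._≤_ (sym n*n∸1+n) (sym 2D+n)
        (ℕ.≤-trans n²≤2u (ℕ.+-monoˡ-≤ n (ℕ.+-mono-≤ (maximal u) (maximal u))))))
      2D≤)
  star⇐ : g ≡ ub → T ≅ star n
  star⇐ g≡ub =
    let f , fc≡0 = move-to-0 c in
    -- Now D = 2n - 3, so the leaf `l`, squeezed between the leaf bound and D, is tight as well.
    centre⇒≅star acyclic (Leaf.leaf-transmission-tight leaf (begin
      transmission l ℕ.+ 3       ≤⟨ ℕ.+-monoˡ-≤ 3 (maximal l) ⟩
      D ℕ.+ 3                    ≡⟨ cong (ℕ._+ 3) 2n∸3≡D ⟨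
      2 ℕ.* n ℕ.∸ 3 ℕ.+ 3        ≡⟨ ℕ.m∸n+n≡m (ℕ.<⇒≤ 3<2n) ⟩
      2 ℕ.* n                    ≡⟨ ℕ.*-comm 2 n ⟩
      n ℕ.* 2                    ∎)) f fc≡0
    where
    open ℕ.≤-Reasoning
    2n∸3≡D : 2 ℕ.* n ℕ.∸ 3 ≡ D
    2n∸3≡D = ℕ.*-cancelˡ-≡ (2 ℕ.* n ℕ.∸ 3) D n {{ℕ.>-nonZero (ℕ.<⇒≤ n≥2)}}
      (fraction-injective n D n (2 ℕ.* n ℕ.∸ 3) g≡ub)
  star⇒ : T ≅ star n → g ≡ ub
  -- The star bound applies to `v` wherever it sits, centre or not.
  star⇒ T≅S = fraction-cong n D n (2 ℕ.* n ℕ.∸ 3) (cong (n ℕ.*_)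
    (ℕ.≤-antisym 2n∸3≤D (ℕ.m+n≤o⇒m≤o∸n D
      (subst (D ℕ.+ 3 ℕ.≤_) (ℕ.*-comm n 2) (star-transmission T≅S v _ (proj₂ (another n≥2 v)))))))
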